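{- Suppose there exists an algorithm $A$ of time complexity $T(r)=\Omega(r)$ that solves the average-case subset sum problem with constant success probability at some constant density $\Delta<1$. Then, for any constant $k$, there is an algorithm $B$ with the same time complexity that can solve the planted search $k$-SUM problem on groups of the form $\mathbb{Z}_p$ (where $p$ is a prime larger than $k$) at density $\frac{k\Delta\log r}{r}$ with constant success probability.
   Context: All logarithms are base 2; algorithms may be randomized. Average-case subset sum, with parameters $r$ and $N$ ($N$ a prime power): choose $\mathbf{A}\in\mathbb{Z}_N^r$ and $\mathbf{x}\in\{0,1\}^r$ uniformly and independently at random; given $\mathbf{A}$ and $\mathbf{A}\cdot\mathbf{x}\bmod N$, the algorithm must return, with constant probability (over the input and its coins), some $\mathbf{x}'\in\{0,1\}^r$ with $\mathbf{A}\cdot\mathbf{x}'=\mathbf{A}\cdot\mathbf{x}\bmod N$. The density of the subset sum instance is $\frac{r}{\log N}$; running time is expressed as a function of $r$ for fixed density. Planted search $k$-SUM over $\mathbb{Z}_p$ with $r$ elements: sample $X_1,\dots,X_r$ i.i.d. uniformly from $\mathbb{Z}_p$; choose a uniformly random $S\subseteq[r]$ with $|S|=k$; let $i=\min S$ and replace $X_i$ by $-\sum_{j\in S,j\ne i}X_j$. Given $X=(X_1,\dots,X_r)$, the task is to output a set $S'\subseteq[r]$ with $|S'|=k$ and $\sum_{i\in S'}X_i=0$; success probability is over the instance and the coins. The $k$-SUM density is $\frac{k\log r}{\log p}$. -}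

module Defs where

open import Data.Bool.Base using (Bool; true; false; if_then_else_; _∧_)
open import Data.Fin.Base using (Fin; zero; suc; toℕ)
open import Data.Fin.Properties using () renaming (_≟_ to _≟ᶠ_)
open import Data.Fin.Subset using (Subset; inside; outside; ∣_∣; _-_)
open import Data.Integer.Base using (+_)
open import Data.List.Base using (List; []; _∷_; _++_; length; lookup; map; filter)
open import Data.Maybe.Base as Maybe using (Maybe; just; nothing; maybe′)
open import Data.Nat.Base hiding (_/_; _%_)
open import Data.Nat.DivMod using (_/_; _%_; _mod_)
open import Data.Nat.Logarithm using (⌈log₂_⌉)
open import Data.Nat.Primality using (Prime; prime⇒nonZero)
open import Data.Nat.Properties using (_≟_; m^n≢0)
open import Data.Product.Base using (∃; ∃₂; _×_; _,_)
open import Data.Rational.Base as ℚ using (ℚ; 0ℚ; 1ℚ)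
open import Data.Rational.Properties as ℚₚ using ()
open import Data.Sum.Base using (_⊎_)
open import Data.Vec.Base as Vec using (Vec; []; _∷_; _[_]≔_)
open import Function.Base using (_∘_)
open import Function.Bundles using (_⇔_)
open import Relation.Binary.PropositionalEquality.Core using (_≡_; refl)
open import Relation.Nullary.Decidable.Core using (does)
open import Relation.Nullary.Negation.Core using (¬_)

open import Algebra.Properties.CommutativeMonoid.Sum ℚₚ.+-0-commutativeMonoid
  using (sum)

------------------------------------------------------------------------
-- Real numbers as Dedekind cuts of ℚ

record Cut : Set₁ where
  constructor cut
  field
    lower : ℚ → Set  -- q < x
    upper : ℚ → Set  -- x < q

open Cut public

record IsReal (x : Cut) : Set where
  field
    lower-inhabited : ∃ λ q → lower x q
    upper-inhabited : ∃ λ q → upper x q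
    lower-rounded   : ∀ q → lower x q ⇔ (∃ λ s → q ℚ.< s × lower x s)
    upper-rounded   : ∀ q → upper x q ⇔ (∃ λ s → s ℚ.< q × upper x s)
    disjoint        : ∀ q → ¬ (lower x q × upper x q)
    located         : ∀ {q s} → q ℚ.< s → lower x q ⊎ upper x s

infix  4 _<ʳ_
infixl 7 _·ʳ_ _÷ʳ_

_<ʳ_ : Cut → Cut → Set
x <ʳ y = ∃ λ q → upper x q × lower y q

fromℚ : ℚ → Cut
fromℚ q = cut (ℚ._< q) (q ℚ.<_)

fromℕ : ℕ → Cut
fromℕ n = fromℚ (+ n ℚ./ 1)

-- Products and quotients are those of positive reals; only positive
-- quantities are ever compared.

_·ʳ_ : Cut → Cut → Cut
x ·ʳ y = cut
  (λ q → ∃₂ λ s t → 0ℚ ℚ.< s × 0ℚ ℚ.< t × lower x s × lower y t × q ℚ.≤ s ℚ.* t)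
  (λ q → ∃₂ λ s t → 0ℚ ℚ.< s × 0ℚ ℚ.< t × upper x s × upper y t × s ℚ.* t ℚ.≤ q)

_÷ʳ_ : Cut → Cut → Cut
x ÷ʳ y = cut
  (λ q → ∃₂ λ s t → 0ℚ ℚ.< s × 0ℚ ℚ.< t × lower x s × upper y t × q ℚ.* t ℚ.≤ s)
  (λ q → ∃₂ λ s t → 0ℚ ℚ.< s × 0ℚ ℚ.< t × upper x s × lower y t × s ℚ.≤ q ℚ.* t)

-- a / b < log₂ n  iff  2 ^ a < n ^ b,  for b > 0 and n ≥ 2.

log₂ : ℕ → Cut
log₂ n = cut
  (λ q → ∃₂ λ a b → q ℚ.≤ (+ a ℚ./ suc b) × 2 ^ a < n ^ suc b)
  (λ q → ∃₂ λ a b → (+ a ℚ./ suc b) ℚ.≤ q × n ^ suc b < 2 ^ a)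

------------------------------------------------------------------------
-- Asymptotics

Eventually : (ℕ → Set) → Set
Eventually P = ∃ λ r₀ → ∀ r → r₀ ≤ r → P r

-- f / g → 1, for eventually positive f and g.

infix 4 _∼_

_∼_ : (ℕ → Cut) → (ℕ → Cut) → Set
f ∼ g = ∀ ε → 0ℚ ℚ.< ε → Eventually λ r →
  (f r <ʳ fromℚ (1ℚ ℚ.+ ε) ·ʳ g r) × (g r <ʳ fromℚ (1ℚ ℚ.+ ε) ·ʳ f r)

-- T(r) = Ω(r)

AtLeastLinear : (ℕ → ℕ) → Set
AtLeastLinear T = ∃ λ C → Eventually λ r → r ≤ C * T r

------------------------------------------------------------------------
-- Finite randomized experiments.  `choose n` draws uniformly from Fin n;
-- `choose 0` yields nothing and contributes probability 0.

data Rand (A : Set) : Set where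
  return : A → Rand A
  choose : (n : ℕ) → (Fin n → Rand A) → Rand A

infixl 1 _>>=_

_>>=_ : {A B : Set} → Rand A → (A → Rand B) → Rand B
return a   >>= k = k a
choose n f >>= k = choose n (λ i → f i >>= k)

uniform : ∀ n → Rand (Fin n)
uniform n = choose n return

uniformFrom : {A : Set} → List A → Rand A
uniformFrom xs = choose (length xs) (return ∘ lookup xs)

iid : {A : Set} → Rand A → ∀ r → Rand (Vec A r)
iid d zero    = return []
iid d (suc r) = d >>= λ x → iid d r >>= λ xs → return (x ∷ xs)

Pr : Rand Bool → ℚ
Pr (return b)         = if b then 1ℚ else 0ℚ
Pr (choose zero    f) = 0ℚ
Pr (choose (suc n) f) = (+ 1 ℚ./ suc n) ℚ.* sum (λ i → Pr (f i))

Always : {A : Set} → (A → Set) → Rand A → Set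
Always P (return a)   = P a
Always P (choose n f) = ∀ i → Always P (f i)

------------------------------------------------------------------------
-- Randomized word RAM.  A program addresses finitely many arrays by
-- literal names; array cells and array indices are w-bit words.  A single
-- program serves all parameters, so each statement, whose expressions
-- have a size fixed by the program, takes one unit of time.

data Op : Set where
  add sub mul div rem band shl shr eq lt : Op

data Expr : Set where
  const : ℕ → Expr
  _⟨_⟩  : ℕ → Expr → Expr                -- array name, index
  _⟦_⟧_ : Expr → Op → Expr → Expr

data Stmt : Set where
  _⟨_⟩:=_   : ℕ → Expr → Expr → Stmt
  _⟨_⟩:=$_  : ℕ → Expr → Expr → Stmt     -- store a random word below a bound
  ifte      : Expr → List Stmt → List Stmt → Stmt
  while     : Expr → List Stmt → Stmt

Program : Set
Program = List Stmt

Store : Set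
Store = ℕ → ℕ → ℕ

bitwiseAnd : ℕ → ℕ → ℕ → ℕ
bitwiseAnd zero    a b = 0
bitwiseAnd (suc w) a b = (a % 2) * (b % 2) + 2 * bitwiseAnd w (a / 2) (b / 2)

-- Subtraction is truncated at 0, and division by 0 gives 0.

apply : ℕ → Op → ℕ → ℕ → ℕ
apply w add  a b       = a + b
apply w sub  a b       = a ∸ b
apply w mul  a b       = a * b
apply w div  a zero    = 0
apply w div  a (suc b) = a / suc b
apply w rem  a zero    = 0
apply w rem  a (suc b) = a % suc b
apply w band a b       = bitwiseAnd w a b
apply w shl  a b       = a * 2 ^ b
apply w shr  a b       = _/_ a (2 ^ b) {{m^n≢0 2 b}}
apply w eq   a b       = if a ≡ᵇ b then 1 else 0
apply w lt   a b       = if a <ᵇ b then 1 else 0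

toWord : ℕ → ℕ → ℕ
toWord w n = _%_ n (2 ^ w) {{m^n≢0 2 w}}

eval : ℕ → Store → Expr → ℕ
eval w σ (const n)     = toWord w n
eval w σ (a ⟨ e ⟩)     = σ a (eval w σ e)
eval w σ (e ⟦ o ⟧ e′)  = toWord w (apply w o (eval w σ e) (eval w σ e′))

write : Store → ℕ → ℕ → ℕ → Store
write σ a i v a′ i′ = if (a′ ≡ᵇ a) ∧ (i′ ≡ᵇ i) then v else σ a′ i′

-- The statements still to be executed, and the memory.

Config : Set
Config = List Stmt × Store

step : ℕ → Config → Rand Config
step w ([] , σ) = return ([] , σ)
step w ((a ⟨ e ⟩:= e′) ∷ ss , σ) =
  return (ss , write σ a (eval w σ e) (eval w σ e′))
step w ((a ⟨ e ⟩:=$ e′) ∷ ss , σ) =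
  choose (suc (pred (eval w σ e′))) λ v →
    return (ss , write σ a (eval w σ e) (toℕ v))
step w (ifte e s₁ s₂ ∷ ss , σ) with eval w σ e
... | zero  = return (s₂ ++ ss , σ)
... | suc _ = return (s₁ ++ ss , σ)
step w (while e s ∷ ss , σ) with eval w σ e
... | zero  = return (ss , σ)
... | suc _ = return (s ++ while e s ∷ ss , σ)

run : ℕ → ℕ → Config → Rand Config
run w zero    c = return c
run w (suc τ) c = step w c >>= run w τ

Halted : Config → Set
Halted (ss , _) = ss ≡ []

halted : Config → Bool
halted ([]    , _) = true
halted (_ ∷ _ , _) = false

-- Words are wide enough for the product of two numbers bounded by r + N.

wordSize : ℕ → ℕ → ℕ
wordSize r N = 2 * ⌈log₂ (r + N) ⌉

cell : {A : Set} → A → List A → ℕ → A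
cell d []       _       = d
cell d (x ∷ xs) zero    = x
cell d (x ∷ xs) (suc i) = cell d xs i

-- Arrays 0, 1, … hold the given lists; every other cell is 0.

memory : List (List ℕ) → Store
memory xss a i = cell 0 (cell [] xss a) i

start : Program → List (List ℕ) → Config
start P input = P , memory input

-- The answer is the bit vector (equivalently, the subset) in array 2.

answer : ∀ {r} → Config → Subset r
answer (_ , σ) = Vec.tabulate λ i → σ 2 (toℕ i) ≡ᵇ 1

------------------------------------------------------------------------
-- ℤ_N is Fin N.  A vector x ∈ {0,1}^r is identified with the subset
-- { i | xᵢ = 1 }, so that ∑[ x ] A is the inner product A · x.

∑ℕ : ∀ {N r} → Subset r → Vec (Fin N) r → ℕ
∑ℕ []            []      = 0
∑ℕ (outside ∷ S) (_ ∷ X) = ∑ℕ S X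
∑ℕ (inside  ∷ S) (x ∷ X) = toℕ x + ∑ℕ S X

module _ {N : ℕ} .{{_ : NonZero N}} where

  ∑[_] : ∀ {r} → Subset r → Vec (Fin N) r → Fin N
  ∑[ S ] X = ∑ℕ S X mod N

  neg : Fin N → Fin N
  neg x = (N ∸ toℕ x) mod N

  zeroₙ : Fin N
  zeroₙ = 0 mod N

words : ∀ {N r} → Vec (Fin N) r → List ℕ
words X = map toℕ (Vec.toList X)

------------------------------------------------------------------------
-- Average-case subset sum

PrimePower : ℕ → Set
PrimePower N = ∃₂ λ q e → Prime q × 1 ≤ e × N ≡ q ^ e

primePower⇒nonZero : ∀ {N} → PrimePower N → NonZero N
primePower⇒nonZero (q , e , pr , _ , refl) = m^n≢0 q e {{prime⇒nonZero pr}}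

subsetSumInput : ∀ {N r} → Vec (Fin N) r → Fin N → List (List ℕ)
subsetSumInput {N} {r} A t = (r ∷ N ∷ toℕ t ∷ []) ∷ words A ∷ []

module SubsetSum (P : Program) (r N : ℕ) .{{_ : NonZero N}} (τ : ℕ) where

  execute : Vec (Fin N) r → Fin N → Rand Config
  execute A t = run (wordSize r N) τ (start P (subsetSumInput A t))

  HaltsInTime : Set
  HaltsInTime = ∀ A t → Always Halted (execute A t)

  experiment : Rand Bool
  experiment =
    iid (uniform N) r                              >>= λ A →
    iid (uniformFrom (outside ∷ inside ∷ [])) r    >>= λ x →
    execute A (∑[ x ] A)                           >>= λ c →
    return (halted c ∧ does (∑[ answer c ] A ≟ᶠ ∑[ x ] A))

-- P runs in time O(T(r)) and has constant success probability at density
-- Δ.  As N is an integer, density Δ means that the densities r / log N(r)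
-- of the instances tend to Δ.

SolvesSubsetSum : Program → (Δ : Cut) → (T : ℕ → ℕ) → Set
SolvesSubsetSum P Δ T =
  ∃₂ λ (C : ℕ) (c : ℚ) → 0ℚ ℚ.< c ×
  ((N : ℕ → ℕ) (pp : ∀ r → PrimePower (N r)) →
   (λ r → fromℕ r ÷ʳ log₂ (N r)) ∼ (λ _ → Δ) →
   Eventually λ r →
     let open SubsetSum P r (N r) {{primePower⇒nonZero (pp r)}} (C * T r)
     in HaltsInTime × c ℚ.≤ Pr experiment)

------------------------------------------------------------------------
-- Planted search k-SUM

allSubsets : ∀ r → List (Subset r)
allSubsets zero    = [] ∷ []
allSubsets (suc r) =
  map (outside ∷_) (allSubsets r) ++ map (inside ∷_) (allSubsets r)

subsetsOfSize : ℕ → ∀ r → List (Subset r)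
subsetsOfSize k r = filter (λ S → ∣ S ∣ ≟ k) (allSubsets r)

min : ∀ {r} → Subset r → Maybe (Fin r)
min []            = nothing
min (inside  ∷ S) = just zero
min (outside ∷ S) = Maybe.map suc (min S)

plant : ∀ {p r} .{{_ : NonZero p}} →
        Subset r → Vec (Fin p) r → Vec (Fin p) r
plant S X = maybe′ (λ i → X [ i ]≔ neg (∑[ S - i ] X)) X (min S)

kSumInput : ∀ {p r} → Vec (Fin p) r → List (List ℕ)
kSumInput {p} {r} X = (r ∷ p ∷ []) ∷ words X ∷ []

module KSum (k : ℕ) (P : Program) (r p : ℕ) .{{_ : NonZero p}} (τ : ℕ) where

  execute : Vec (Fin p) r → Rand Config
  execute X = run (wordSize r p) τ (start P (kSumInput X))

  HaltsInTime : Set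
  HaltsInTime = ∀ X → Always Halted (execute X)

  isSolution : Vec (Fin p) r → Subset r → Bool
  isSolution X S = does (∣ S ∣ ≟ k) ∧ does (∑[ S ] X ≟ᶠ zeroₙ)

  experiment : Rand Bool
  experiment =
    iid (uniform p) r                  >>= λ X₀ →
    uniformFrom (subsetsOfSize k r)    >>= λ S →
    let X = plant S X₀ in
    execute X                          >>= λ c →
    return (halted c ∧ isSolution X (answer c))

-- As p(r) is an integer, density δ means that k log r / log p(r) ∼ δ(r).

SolvesPlantedKSum : ℕ → Program → (δ : ℕ → Cut) → (T : ℕ → ℕ) → Set
SolvesPlantedKSum k P δ T =
  ∃₂ λ (C : ℕ) (c : ℚ) → 0ℚ ℚ.< c ×
  ((p : ℕ → ℕ) (prime : ∀ r → Prime (p r)) → (∀ r → k < p r) →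
   (λ r → fromℕ k ·ʳ log₂ r ÷ʳ log₂ (p r)) ∼ δ →
   Eventually λ r →
     let open KSum k P r (p r) {{prime⇒nonZero (prime r)}} (C * T r)
     in HaltsInTime × c ℚ.≤ Pr experiment)

{-# OPTIONS --safe #-}
module Submission where

-- Given a k-SUM instance X with planted solution S, draw s ∈ ℤ_p and y ∈ {0,1}^r, and put
-- A_j = ±(X_j + s) with sign − exactly where y_j = 1.  Then x = S xor y satisfies
-- A · x = k s + ∑_{y_j = 1} A_j, which is computable without knowing S.  As k is invertible
-- mod p, the pair (A , x) is exactly uniform, so the subset-sum algorithm returns some x′
-- with A · x′ = A · x with constant probability.  At density Δ < 1 we have 2^r / p → 0, so
-- by a union bound x′ = x for all but a small fraction of the instances, and then
-- x′ xor y = S.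

open import Algebra.Bundles using (CommutativeRing)
open import Data.Bool.Base using (Bool; true; false; if_then_else_; _∧_; _xor_; not)
open import Data.Bool.Properties as Bool using (T-≡; xor-comm; xor-assoc; xor-same)
open import Data.Fin.Base using (Fin; zero; suc; toℕ; punchOut)
open import Data.Fin.Permutation using (permutation)
open import Data.Fin.Properties as Finₚ
  using (any?; injective⇒≤; punchOut-injective; toℕ-fromℕ<; toℕ<n; toℕ-injective)
  renaming (_≟_ to _≟ᶠ_)
open import Data.Fin.Subset using (Subset; inside; outside; ∣_∣; _-_)
open import Data.Fin.Subset.Properties using (p─⊥≡p)
open import Data.Integer.Base as ℤ using (-[1+_])
import Data.Integer.Properties as ℤₚ
open import Data.List.Base as List using (List; []; _∷_; _++_; length)
open import Data.List.Membership.Propositional using (_∈_)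
open import Data.List.Membership.Propositional.Properties
  using (∈-++⁺ˡ; ∈-++⁺ʳ; ∈-map⁺; ∈-filter⁺; ∈-lookup)
open import Data.List.Properties using (++-assoc)
open import Data.List.Relation.Unary.All as All using (All)
open import Data.List.Relation.Unary.All.Properties using (all-filter)
open import Data.List.Relation.Unary.Any using (here; there)
open import Data.Maybe.Base as Maybe using (just)
open import Data.Nat.Base hiding (_/_; _%_; ∣_-_∣)
open import Data.Nat.Divisibility using (_∣_; m%n≡0⇒n∣m; ∣⇒≤)
open import Data.Nat.DivMod
  using (_%_; _mod_; m%n<n; m<n⇒m%n≡m; m%n%n≡m%n; %-distribˡ-+; [m+n]%n≡m%n)
open import Data.Nat.Induction using (<-rec)
open import Data.Nat.Logarithm using (⌈log₂_⌉; ⌈log₂⌉-mono-≤; ⌈log₂⌈n/2⌉⌉≡⌈log₂n⌉∸1)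
open import Data.Nat.Primality using (Prime; prime⇒nonZero; euclidsLemma)
open import Data.Nat.Properties
open import Data.Nat.Tactic.RingSolver using (solve-∀)
open import Data.Product.Base using (∃; ∃₂; _×_; _,_; proj₁; proj₂)
open import Data.Rational.Base as ℚ using (ℚ; 0ℚ; 1ℚ; mkℚ)
import Data.Rational.Properties as ℚₚ
open import Data.Rational.Unnormalised.Base as ℚᵘ using (mkℚᵘ)
import Data.Rational.Unnormalised.Properties as ℚᵘₚ
open import Data.Sum.Base using (inj₁; inj₂)
open import Data.Vec.Base as Vec using (Vec; []; _∷_; lookup)
open import Data.Vec.Properties
  using (map-[]≔; tabulate-cong; zipWith-comm; zipWith-replicate₁)
  renaming (≡-dec to ≡-decᵛ)
open import Function.Base using (_∘_; case_of_)
open import Function.Bundles using (Equivalence)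
open import Function.Definitions using (Injective)
open import Relation.Binary.PropositionalEquality hiding ([_])
open import Relation.Nullary using (Dec; yes; no; does; contradiction)
open import Relation.Nullary.Decidable using (dec-true)
open import Defs

open import Algebra.Properties.Semiring.Sum
  (CommutativeRing.semiring ℚₚ.+-*-commutativeRing)
  using (sum; sum-cong-≗; ∑-distrib-+; ∑-comm; sum-permute; *-distribˡ-sum)
import Algebra.Solver.CommutativeMonoid ℚₚ.*-1-commutativeMonoid as ℚ*


-- The planted `S` has only `k` ones and is tied to `X` by a linear relation, while success is
-- promised only for independent uniform `A` and `x`. The bits `y` hide the sparsity of `S`; the
-- translation hides the relation, because it turns the sum over `S` from 0 into the uniform value
-- `k s`. All laws are compared exactly, by bijective changes of variables inside finite averages,
-- so no statistical distance appears. The only loss is the event that another solution is returned,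
-- and it is bounded by counting all colliding vectors, a quantity that depends neither on the
-- algorithm nor on its coins. With N = p both problems have the same modulus and word size, and the
-- factors `k` and `log r` cancel from the k-SUM density, which leaves r / log p ∼ Δ. At machine
-- level the given program is a black box. It runs in arrays moved up by five, and this run is
-- coupled, draw by draw, with a run on a memory of its own.

private variable
  A B D : Set

-- Fractions of natural numbers

fromNat : ℕ → ℚ
fromNat n = ℤ.+ n ℚ./ 1

0≤1 : 0ℚ ℚ.≤ 1ℚ
0≤1 = ℚₚ.nonNegative⁻¹ 1ℚ

frac : ℕ → ℕ → ℚ
frac a b = ℤ.+ a ℚ./ suc b

toℚᵘ-frac : ∀ a b → ℚ.toℚᵘ (frac a b) ℚᵘ.≃ mkℚᵘ (ℤ.+ a) b
toℚᵘ-frac a b = ℚₚ.toℚᵘ-fromℚᵘ (mkℚᵘ (ℤ.+ a) b)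

frac-* : ∀ a b c d → frac a b ℚ.* frac c d ≡ frac (a * c) (d + b * suc d)
frac-* a b c d = ℚₚ.toℚᵘ-injective (begin
  ℚ.toℚᵘ (frac a b ℚ.* frac c d)
    ≈⟨ ℚₚ.toℚᵘ-homo-* (frac a b) (frac c d) ⟩
  ℚ.toℚᵘ (frac a b) ℚᵘ.* ℚ.toℚᵘ (frac c d)
    ≈⟨ ℚᵘₚ.*-cong (toℚᵘ-frac a b) (toℚᵘ-frac c d) ⟩
  mkℚᵘ (ℤ.+ a) b ℚᵘ.* mkℚᵘ (ℤ.+ c) d
    ≈⟨ ℚᵘ.*≡* (cong (ℤ._* ℤ.+ (suc b * suc d)) (sym (ℤₚ.pos-* a c))) ⟩
  mkℚᵘ (ℤ.+ (a * c)) (d + b * suc d)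
    ≈⟨ toℚᵘ-frac _ _ ⟨
  ℚ.toℚᵘ (frac (a * c) (d + b * suc d)) ∎)
  where open ℚᵘₚ.≃-Reasoning

frac-≤ : ∀ {a b c d} → a * suc d ≤ c * suc b → frac a b ℚ.≤ frac c d
frac-≤ {a} {b} {c} {d} le = ℚₚ.toℚᵘ-cancel-≤ (begin
  ℚ.toℚᵘ (frac a b) ≃⟨ toℚᵘ-frac a b ⟩
  mkℚᵘ (ℤ.+ a) b      ≤⟨ ℚᵘ.*≤* (subst₂ ℤ._≤_ (ℤₚ.pos-* a (suc d)) (ℤₚ.pos-* c (suc b)) (ℤ.+≤+ le)) ⟩
  mkℚᵘ (ℤ.+ c) d      ≃⟨ toℚᵘ-frac c d ⟨
  ℚ.toℚᵘ (frac c d) ∎)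
  where open ℚᵘₚ.≤-Reasoning

frac-< : ∀ {a b c d} → a * suc d < c * suc b → frac a b ℚ.< frac c d
frac-< {a} {b} {c} {d} a<c = ℚₚ.toℚᵘ-cancel-< (begin-strict
  ℚ.toℚᵘ (frac a b) ≃⟨ toℚᵘ-frac a b ⟩
  mkℚᵘ (ℤ.+ a) b      <⟨ ℚᵘ.*<* (subst₂ ℤ._<_ (ℤₚ.pos-* a (suc d)) (ℤₚ.pos-* c (suc b)) (ℤ.+<+ a<c)) ⟩
  mkℚᵘ (ℤ.+ c) d      ≃⟨ toℚᵘ-frac c d ⟨
  ℚ.toℚᵘ (frac c d) ∎)
  where open ℚᵘₚ.≤-Reasoning

frac-<⁻¹ : ∀ {a b c d} → frac a b ℚ.< frac c d → a * suc d < c * suc b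
frac-<⁻¹ {a} {b} {c} {d} a<c = ≰⇒> λ le →
  ℚₚ.<-irrefl refl (ℚₚ.<-≤-trans a<c (frac-≤ {c} {d} {a} {b} le))

frac-cong : ∀ {a b c d} → a * suc d ≡ c * suc b → frac a b ≡ frac c d
frac-cong {a} {b} {c} {d} ad≡cb = ℚₚ.≤-antisym
  (frac-≤ {a} {b} {c} {d} (≤-reflexive ad≡cb)) (frac-≤ {c} {d} {a} {b} (≤-reflexive (sym ad≡cb)))

fromNat-+ : ∀ m n → fromNat (m + n) ≡ fromNat m ℚ.+ fromNat n
fromNat-+ m n = ℚₚ.toℚᵘ-injective (begin
  ℚ.toℚᵘ (fromNat (m + n)) ≈⟨ toℚᵘ-frac (m + n) 0 ⟩
  mkℚᵘ (ℤ.+ (m + n)) 0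
    ≈⟨ ℚᵘ.*≡* (cong (ℤ._* ℤ.+ 1) (cong₂ ℤ._+_ (sym (ℤₚ.*-identityʳ (ℤ.+ m))) (sym (ℤₚ.*-identityʳ (ℤ.+ n))))) ⟩
  mkℚᵘ (ℤ.+ m) 0 ℚᵘ.+ mkℚᵘ (ℤ.+ n) 0
    ≈⟨ ℚᵘₚ.+-cong (toℚᵘ-frac m 0) (toℚᵘ-frac n 0) ⟨
  ℚ.toℚᵘ (fromNat m) ℚᵘ.+ ℚ.toℚᵘ (fromNat n)
    ≈⟨ ℚₚ.toℚᵘ-homo-+ (fromNat m) (fromNat n) ⟨
  ℚ.toℚᵘ (fromNat m ℚ.+ fromNat n) ∎)
  where open ℚᵘₚ.≃-Reasoning

frac-*-fromNat : ∀ n → frac 1 n ℚ.* fromNat (suc n) ≡ 1ℚ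
frac-*-fromNat n = trans (frac-* 1 n (suc n) 0)
  (frac-cong {1 * suc n} {n * 1} {1} {0} (trans (*-identityʳ (1 * suc n))
    (cong (λ m → 1 * suc m) (sym (*-identityʳ n)))))

frac-nonNeg : ∀ a b → ℚ.NonNegative (frac a b)
frac-nonNeg a b = ℚₚ.normalize-nonNeg a (suc b)

-- Averages

-- The value 0 at `n = 0` matches `Pr` on an empty draw. Averages can therefore lose mass, which is
-- why `avg-const` asks for a nonempty range.
avg : ∀ n → (Fin n → ℚ) → ℚ
avg zero    f = 0ℚ
avg (suc n) f = frac 1 n ℚ.* sum f

sum-mono : ∀ {n} {f g : Fin n → ℚ} → (∀ i → f i ℚ.≤ g i) → sum f ℚ.≤ sum g
sum-mono {zero}  f≤g = ℚₚ.≤-refl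
sum-mono {suc n} f≤g = ℚₚ.+-mono-≤ (f≤g zero) (sum-mono (f≤g ∘ suc))

sum-const : ∀ n c → sum {n} (λ _ → c) ≡ fromNat n ℚ.* c
sum-const zero    c = sym (ℚₚ.*-zeroˡ c)
sum-const (suc n) c = begin
  c ℚ.+ sum {n} (λ _ → c)               ≡⟨ cong₂ ℚ._+_ (sym (ℚₚ.*-identityˡ c)) (sum-const n c) ⟩
  1ℚ ℚ.* c ℚ.+ fromNat n ℚ.* c          ≡⟨ ℚₚ.*-distribʳ-+ c 1ℚ (fromNat n) ⟨
  (1ℚ ℚ.+ fromNat n) ℚ.* c              ≡⟨ cong (ℚ._* c) (fromNat-+ 1 n) ⟨
  fromNat (suc n) ℚ.* c                 ∎
  where open ≡-Reasoning

avg-cong : ∀ n {f g : Fin n → ℚ} → f ≗ g → avg n f ≡ avg n g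
avg-cong zero    f≗g = refl
avg-cong (suc n) f≗g = cong (frac 1 n ℚ.*_) (sum-cong-≗ f≗g)

avg-mono : ∀ n {f g : Fin n → ℚ} → (∀ i → f i ℚ.≤ g i) → avg n f ℚ.≤ avg n g
avg-mono zero    f≤g = ℚₚ.≤-refl
avg-mono (suc n) f≤g =
  ℚₚ.*-monoˡ-≤-nonNeg (frac 1 n) {{frac-nonNeg 1 n}} (sum-mono f≤g)

avg-zero : ∀ n → avg n (λ _ → 0ℚ) ≡ 0ℚ
avg-zero zero    = refl
avg-zero (suc n) = trans (cong (frac 1 n ℚ.*_)
  (trans (sum-const (suc n) 0ℚ) (ℚₚ.*-zeroʳ (fromNat (suc n))))) (ℚₚ.*-zeroʳ (frac 1 n))

avg-const : ∀ n .{{_ : NonZero n}} c → avg n (λ _ → c) ≡ c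
avg-const (suc n) c = begin
  frac 1 n ℚ.* sum {suc n} (λ _ → c)        ≡⟨ cong (frac 1 n ℚ.*_) (sum-const (suc n) c) ⟩
  frac 1 n ℚ.* (fromNat (suc n) ℚ.* c)      ≡⟨ ℚₚ.*-assoc (frac 1 n) (fromNat (suc n)) c ⟨
  frac 1 n ℚ.* fromNat (suc n) ℚ.* c        ≡⟨ cong (ℚ._* c) (frac-*-fromNat n) ⟩
  1ℚ ℚ.* c                                  ≡⟨ ℚₚ.*-identityˡ c ⟩
  c                                         ∎
  where open ≡-Reasoning

avg-+ : ∀ n (f g : Fin n → ℚ) → avg n (λ i → f i ℚ.+ g i) ≡ avg n f ℚ.+ avg n g
avg-+ zero    f g = refl
avg-+ (suc n) f g = trans (cong (frac 1 n ℚ.*_) (∑-distrib-+ f g))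
  (ℚₚ.*-distribˡ-+ (frac 1 n) (sum f) (sum g))

avg-* : ∀ n c (f : Fin n → ℚ) → avg n (λ i → c ℚ.* f i) ≡ c ℚ.* avg n f
avg-* zero    c f = sym (ℚₚ.*-zeroʳ c)
avg-* (suc n) c f = begin
  frac 1 n ℚ.* sum (λ i → c ℚ.* f i)  ≡⟨ cong (frac 1 n ℚ.*_) (*-distribˡ-sum c f) ⟨
  frac 1 n ℚ.* (c ℚ.* sum f)          ≡⟨ ℚₚ.*-assoc (frac 1 n) c (sum f) ⟨
  frac 1 n ℚ.* c ℚ.* sum f            ≡⟨ cong (ℚ._* sum f) (ℚₚ.*-comm (frac 1 n) c) ⟩
  c ℚ.* frac 1 n ℚ.* sum f            ≡⟨ ℚₚ.*-assoc c (frac 1 n) (sum f) ⟩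
  c ℚ.* (frac 1 n ℚ.* sum f)          ∎
  where open ≡-Reasoning

avg-comm : ∀ m n (f : Fin m → Fin n → ℚ) →
           avg m (λ i → avg n (f i)) ≡ avg n (λ j → avg m (λ i → f i j))
avg-comm zero    n       f = sym (avg-zero n)
avg-comm (suc m) zero    f = avg-zero (suc m)
avg-comm (suc m) (suc n) f = begin
  a ℚ.* sum (λ i → b ℚ.* sum (f i))                ≡⟨ cong (a ℚ.*_) (*-distribˡ-sum b (λ i → sum (f i))) ⟨
  a ℚ.* (b ℚ.* sum (λ i → sum (f i)))              ≡⟨ cong (λ s → a ℚ.* (b ℚ.* s)) (∑-comm f) ⟩
  a ℚ.* (b ℚ.* sum (λ j → sum (λ i → f i j)))      ≡⟨ ℚₚ.*-assoc a b _ ⟨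
  a ℚ.* b ℚ.* sum (λ j → sum (λ i → f i j))        ≡⟨ cong (ℚ._* sum (λ j → sum (λ i → f i j))) (ℚₚ.*-comm a b) ⟩
  b ℚ.* a ℚ.* sum (λ j → sum (λ i → f i j))        ≡⟨ ℚₚ.*-assoc b a _ ⟩
  b ℚ.* (a ℚ.* sum (λ j → sum (λ i → f i j)))      ≡⟨ cong (b ℚ.*_) (*-distribˡ-sum a (λ j → sum (λ i → f i j))) ⟩
  b ℚ.* sum (λ j → a ℚ.* sum (λ i → f i j))        ∎
  where
  open ≡-Reasoning
  a = frac 1 m
  b = frac 1 n

-- Pigeonhole: if `j` were missed, punching it out would inject `Fin (suc n)` into `Fin n`. Thanks
-- to this, translations, negations and affine maps only have to be shown injective to preserve
-- averages.
injective⇒surjective : ∀ {n} {π : Fin n → Fin n} → Injective _≡_ _≡_ π → ∀ j → ∃ λ i → π i ≡ j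
injective⇒surjective {suc n} {π} inj j with any? (λ i → π i ≟ᶠ j)
... | yes found = found
... | no  avoid = contradiction
  (injective⇒≤ {f = λ i → punchOut (avoid′ i)}
    (λ {i} {i′} same → inj (punchOut-injective (avoid′ i) (avoid′ i′) same)))
  1+n≰n
  where
  avoid′ : ∀ i → j ≢ π i
  avoid′ i j≡ = avoid (i , sym j≡)

avg-injective : ∀ n {π : Fin n → Fin n} → Injective _≡_ _≡_ π →
                (f : Fin n → ℚ) → avg n (f ∘ π) ≡ avg n f
avg-injective zero    inj f = refl
avg-injective (suc n) {π} inj f = cong (frac 1 n ℚ.*_) (sym (sum-permute f
  (permutation π (proj₁ ∘ surj) (proj₂ ∘ surj) (λ i → inj (proj₂ (surj (π i)))))))
  where surj = injective⇒surjective inj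

-- Expectations

indicator : Bool → ℚ
indicator b = if b then 1ℚ else 0ℚ

E : Rand A → (A → ℚ) → ℚ
E (return a)   f = f a
E (choose n m) f = avg n (λ i → E (m i) f)

Pr≡E : ∀ m → Pr m ≡ E m indicator
Pr≡E (return b)         = refl
Pr≡E (choose zero    m) = refl
Pr≡E (choose (suc n) m) = cong (frac 1 n ℚ.*_) (sum-cong-≗ (Pr≡E ∘ m))

E-bind : ∀ (m : Rand A) (k : A → Rand B) f → E (m >>= k) f ≡ E m (λ a → E (k a) f)
E-bind (return a)   k f = refl
E-bind (choose n m) k f = avg-cong n (λ i → E-bind (m i) k f)

E-cong : ∀ (m : Rand A) {f g} → f ≗ g → E m f ≡ E m g
E-cong (return a)   f≗g = f≗g a
E-cong (choose n m) f≗g = avg-cong n (λ i → E-cong (m i) f≗g)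

E-mono : ∀ (m : Rand A) {f g} → (∀ a → f a ℚ.≤ g a) → E m f ℚ.≤ E m g
E-mono (return a)   f≤g = f≤g a
E-mono (choose n m) f≤g = avg-mono n (λ i → E-mono (m i) f≤g)

E-+ : ∀ (m : Rand A) f g → E m (λ a → f a ℚ.+ g a) ≡ E m f ℚ.+ E m g
E-+ (return a)   f g = refl
E-+ (choose n m) f g = trans (avg-cong n (λ i → E-+ (m i) f g))
  (avg-+ n (λ i → E (m i) f) (λ i → E (m i) g))

E-* : ∀ (m : Rand A) c f → E m (λ a → c ℚ.* f a) ≡ c ℚ.* E m f
E-* (return a)   c f = refl
E-* (choose n m) c f = trans (avg-cong n (λ i → E-* (m i) c f))
  (avg-* n c (λ i → E (m i) f))

-- Only an inequality: an experiment with an empty draw has total mass below 1. A nonnegative bound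
-- that ignores the outcome can still be pulled out of any run.
E-const-≤ : ∀ (m : Rand A) {c} → 0ℚ ℚ.≤ c → E m (λ _ → c) ℚ.≤ c
E-const-≤ (return a)           0≤c = ℚₚ.≤-refl
E-const-≤ (choose zero    m)   0≤c = 0≤c
E-const-≤ (choose (suc n) m) {c} 0≤c = ℚₚ.≤-trans
  (avg-mono (suc n) (λ i → E-const-≤ (m i) 0≤c)) (ℚₚ.≤-reflexive (avg-const (suc n) c))

E-nonNeg : ∀ (m : Rand A) {f} → (∀ a → 0ℚ ℚ.≤ f a) → 0ℚ ℚ.≤ E m f
E-nonNeg (return a)   0≤f = 0≤f a
E-nonNeg (choose n m) 0≤f = ℚₚ.≤-trans (ℚₚ.≤-reflexive (sym (avg-zero n)))
  (avg-mono n (λ i → E-nonNeg (m i) 0≤f))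

avg-E-comm : ∀ n (m : Rand A) (F : Fin n → A → ℚ) →
             avg n (λ i → E m (F i)) ≡ E m (λ a → avg n (λ i → F i a))
avg-E-comm n (return a)    F = refl
avg-E-comm n (choose n′ m) F = trans (avg-comm n n′ (λ i j → E (m j) (F i)))
  (avg-cong n′ (λ j → avg-E-comm n (m j) F))

E-comm : ∀ (m : Rand A) (m′ : Rand B) (F : A → B → ℚ) →
         E m (λ a → E m′ (F a)) ≡ E m′ (λ b → E m (λ a → F a b))
E-comm (return a)   m′ F = refl
E-comm (choose n m) m′ F = trans (avg-cong n (λ i → E-comm (m i) m′ F))
  (avg-E-comm n m′ (λ i b → E (m i) (λ a → F a b)))

E-iid-∷ : ∀ (d : Rand A) r f →
          E (iid d (suc r)) f ≡ E d (λ x → E (iid d r) (λ xs → f (x ∷ xs)))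
E-iid-∷ d r f = trans (E-bind d _ f) (E-cong d (λ x → E-bind (iid d r) _ f))

-- A measure-preserving change of every coordinate preserves the product.
E-iid-zipWith : ∀ (d : Rand A) (π : B → A → A) →
  (∀ b (f : A → ℚ) → E d (f ∘ π b) ≡ E d f) →
  ∀ {r} (bs : Vec B r) (f : Vec A r → ℚ) →
  E (iid d r) (f ∘ Vec.zipWith π bs) ≡ E (iid d r) f
E-iid-zipWith d π inv []       f = refl
E-iid-zipWith d π inv {suc r} (b ∷ bs) f = begin
  E (iid d (suc r)) (f ∘ Vec.zipWith π (b ∷ bs))
    ≡⟨ E-iid-∷ d r _ ⟩
  E d (λ x → E (iid d r) (λ xs → f (π b x ∷ Vec.zipWith π bs xs)))
    ≡⟨ E-cong d (λ x → E-iid-zipWith d π inv bs (λ xs → f (π b x ∷ xs))) ⟩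
  E d (λ x → E (iid d r) (λ xs → f (π b x ∷ xs)))
    ≡⟨ inv b (λ x → E (iid d r) (λ xs → f (x ∷ xs))) ⟩
  E d (λ x → E (iid d r) (λ xs → f (x ∷ xs)))
    ≡⟨ E-iid-∷ d r f ⟨
  E (iid d (suc r)) f ∎
  where open ≡-Reasoning

-- Resampling one coordinate. The original draw of that coordinate is overwritten, and dropping it
-- costs nothing because `total` says that `d` has mass 1.
E-iid-update : ∀ (d : Rand A) → (∀ c → E d (λ _ → c) ≡ c) →
  ∀ {r} (i : Fin r) (f : Vec A r → ℚ) →
  E (iid d r) (λ xs → E d (λ x → f (xs Vec.[ i ]≔ x))) ≡ E (iid d r) f
E-iid-update d total {suc r} zero f = begin
  E (iid d (suc r)) (λ xs → E d (λ x → f (xs Vec.[ zero ]≔ x)))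
    ≡⟨ E-iid-∷ d r _ ⟩
  E d (λ _ → E (iid d r) (λ xs → E d (λ x → f (x ∷ xs))))
    ≡⟨ total _ ⟩
  E (iid d r) (λ xs → E d (λ x → f (x ∷ xs)))
    ≡⟨ E-comm (iid d r) d (λ xs x → f (x ∷ xs)) ⟩
  E d (λ x → E (iid d r) (λ xs → f (x ∷ xs)))
    ≡⟨ E-iid-∷ d r f ⟨
  E (iid d (suc r)) f ∎
  where open ≡-Reasoning
E-iid-update d total {suc r} (suc i) f = begin
  E (iid d (suc r)) (λ xs → E d (λ x → f (xs Vec.[ suc i ]≔ x)))
    ≡⟨ E-iid-∷ d r _ ⟩
  E d (λ y → E (iid d r) (λ xs → E d (λ x → f (y ∷ xs Vec.[ i ]≔ x))))
    ≡⟨ E-cong d (λ y → E-iid-update d total i (λ xs → f (y ∷ xs))) ⟩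
  E d (λ y → E (iid d r) (λ xs → f (y ∷ xs)))
    ≡⟨ E-iid-∷ d r f ⟨
  E (iid d (suc r)) f ∎
  where open ≡-Reasoning

sum-atMostOne : ∀ {n} (b : Fin n → Bool) →
  (∀ i j → b i ≡ true → b j ≡ true → i ≡ j) → sum (indicator ∘ b) ℚ.≤ 1ℚ
sum-atMostOne {zero}  b unique = 0≤1
sum-atMostOne {suc n} b unique with b zero in b₀
... | false = ℚₚ.≤-trans (ℚₚ.≤-reflexive (ℚₚ.+-identityˡ _))
  (sum-atMostOne (b ∘ suc) λ i j bi bj → Finₚ.suc-injective (unique (suc i) (suc j) bi bj))
... | true  = ℚₚ.≤-reflexive (trans (cong (1ℚ ℚ.+_)
  (trans (sum-cong-≗ rest-zero) (trans (sum-const n 0ℚ) (ℚₚ.*-zeroʳ (fromNat n))))) (ℚₚ.+-identityʳ 1ℚ))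
  where
  rest-zero : ∀ i → indicator (b (suc i)) ≡ 0ℚ
  rest-zero i with b (suc i) in bᵢ
  ... | false = refl
  ... | true  with () ← unique zero (suc i) b₀ bᵢ

avg-atMostOne : ∀ {n} (b : Fin (suc n) → Bool) →
  (∀ i j → b i ≡ true → b j ≡ true → i ≡ j) → avg (suc n) (indicator ∘ b) ℚ.≤ frac 1 n
avg-atMostOne {n} b unique = ℚₚ.≤-trans
  (ℚₚ.*-monoˡ-≤-nonNeg (frac 1 n) {{frac-nonNeg 1 n}} (sum-atMostOne b unique))
  (ℚₚ.≤-reflexive (ℚₚ.*-identityʳ (frac 1 n)))

-- By computation this is both the draw of an entry of `x` in the subset-sum experiment, as
-- `outside` and `inside` are `false` and `true`, and a draw of the machine below the bound 2.
coin : Rand Bool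
coin = uniformFrom (false ∷ true ∷ [])

E-coin-xor : ∀ b (f : Bool → ℚ) → E coin (f ∘ (b xor_)) ≡ E coin f
E-coin-xor false f = refl
E-coin-xor true  f = cong (frac 1 1 ℚ.*_) (begin
  f true ℚ.+ (f false ℚ.+ 0ℚ)  ≡⟨ cong (f true ℚ.+_) (ℚₚ.+-identityʳ (f false)) ⟩
  f true ℚ.+ f false           ≡⟨ ℚₚ.+-comm (f true) (f false) ⟩
  f false ℚ.+ f true           ≡⟨ cong (f false ℚ.+_) (ℚₚ.+-identityʳ (f true)) ⟨
  f false ℚ.+ (f true ℚ.+ 0ℚ)  ∎)
  where open ≡-Reasoning

≤-twice-E-coin : ∀ b (f : Bool → ℚ) → (∀ b → 0ℚ ℚ.≤ f b) → f b ℚ.≤ fromNat 2 ℚ.* E coin f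
≤-twice-E-coin b f 0≤f = ℚₚ.≤-trans (below b) (ℚₚ.≤-reflexive (sym (begin
  fromNat 2 ℚ.* (frac 1 1 ℚ.* (f false ℚ.+ (f true ℚ.+ 0ℚ)))
    ≡⟨ ℚₚ.*-assoc (fromNat 2) (frac 1 1) (f false ℚ.+ (f true ℚ.+ 0ℚ)) ⟨
  1ℚ ℚ.* (f false ℚ.+ (f true ℚ.+ 0ℚ))
    ≡⟨ ℚₚ.*-identityˡ _ ⟩
  f false ℚ.+ (f true ℚ.+ 0ℚ)
    ≡⟨ cong (f false ℚ.+_) (ℚₚ.+-identityʳ (f true)) ⟩
  f false ℚ.+ f true ∎)))
  where
  open ≡-Reasoning
  below : ∀ b → f b ℚ.≤ f false ℚ.+ f true
  below false = ℚₚ.≤-trans (ℚₚ.≤-reflexive (sym (ℚₚ.+-identityʳ (f false))))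
    (ℚₚ.+-monoʳ-≤ (f false) (0≤f true))
  below true  = ℚₚ.≤-trans (ℚₚ.≤-reflexive (sym (ℚₚ.+-identityˡ (f true))))
    (ℚₚ.+-monoˡ-≤ (f true) (0≤f false))

-- Every vector has mass `2^-r`, so scaling the expectation by `2 ^ r` gives the sum of `f` over the
-- whole cube, which dominates each single term. This is the union bound without an explicit sum
-- over the cube.
≤-2^r*E-coins : ∀ {r} (z : Vec Bool r) (f : Vec Bool r → ℚ) → (∀ z → 0ℚ ℚ.≤ f z) →
                f z ℚ.≤ fromNat (2 ^ r) ℚ.* E (iid coin r) f
≤-2^r*E-coins []      f 0≤f = ℚₚ.≤-reflexive (sym (ℚₚ.*-identityˡ (f [])))
≤-2^r*E-coins {suc r} (b ∷ z) f 0≤f = begin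
  f (b ∷ z)
    ≤⟨ ≤-2^r*E-coins z (f ∘ (b ∷_)) (0≤f ∘ (b ∷_)) ⟩
  N ℚ.* F b
    ≤⟨ ℚₚ.*-monoˡ-≤-nonNeg N {{frac-nonNeg (2 ^ r) 0}}
         (≤-twice-E-coin b F (λ b → E-nonNeg (iid coin r) (0≤f ∘ (b ∷_)))) ⟩
  N ℚ.* (fromNat 2 ℚ.* E coin F)
    ≡⟨ ℚₚ.*-assoc N (fromNat 2) (E coin F) ⟨
  N ℚ.* fromNat 2 ℚ.* E coin F
    ≡⟨ cong₂ ℚ._*_ (trans (ℚₚ.*-comm N (fromNat 2)) (frac-* 2 0 (2 ^ r) 0))
         (sym (E-iid-∷ coin r f)) ⟩
  fromNat (2 ^ suc r) ℚ.* E (iid coin (suc r)) f ∎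
  where
  open ℚₚ.≤-Reasoning
  N = fromNat (2 ^ r)
  F = λ b → E (iid coin r) (f ∘ (b ∷_))

E-uniformFrom-mono : ∀ {P : A → Set} {xs : List A} {f g} → All P xs →
  (∀ x → P x → f x ℚ.≤ g x) → E (uniformFrom xs) f ℚ.≤ E (uniformFrom xs) g
E-uniformFrom-mono {xs = xs} Pxs f≤g = avg-mono (length xs)
  (λ i → f≤g (List.lookup xs i) (All.lookup Pxs (∈-lookup i)))

-- Coupled experiments

-- R-related outcomes of two experiments that make the same sequence of draws.
data Lift {A B : Set} (R : A → B → Set) : Rand A → Rand B → Set where
  return : ∀ {a b} → R a b → Lift R (return a) (return b)
  choose : ∀ {n f g} → (∀ i → Lift R (f i) (g i)) → Lift R (choose n f) (choose n g)

Lift-E : ∀ {R : A → B → Set} {m m′ f g} → Lift R m m′ →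
         (∀ a b → R a b → f b ℚ.≤ g a) → E m′ f ℚ.≤ E m g
Lift-E (return ab)      f≤g = f≤g _ _ ab
Lift-E (choose {n} ms)  f≤g = avg-mono n (λ i → Lift-E (ms i) f≤g)

Lift-Always : ∀ {R : A → B → Set} {P : A → Set} {m m′} → Lift R m m′ →
              (∀ a b → R a b → P a) → Always P m
Lift-Always (return ab) R⇒P = R⇒P _ _ ab
Lift-Always (choose ms) R⇒P = λ i → Lift-Always (ms i) R⇒P

-- Associativity of bind holds only by induction on the first experiment. It is needed because `iid`
-- nests its binds to the left of the continuation.
Lift-assoc : ∀ {C : Set} {R : D → C → Set} {m} (m′ : Rand A) {k : A → Rand B} {h : B → Rand C} →
             Lift R m (m′ >>= λ a → k a >>= h) → Lift R m (m′ >>= k >>= h)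
Lift-assoc (return a)   lift        = lift
Lift-assoc (choose n f) (choose ms) = choose (λ i → Lift-assoc (f i) (ms i))

run-halted : ∀ w τ σ → run w τ ([] , σ) ≡ return ([] , σ)
run-halted w zero    σ = refl
run-halted w (suc τ) σ = run-halted w τ σ

≡ᵇ-refl : ∀ n → (n ≡ᵇ n) ≡ true
≡ᵇ-refl zero    = refl
≡ᵇ-refl (suc n) = ≡ᵇ-refl n

<ᵇ-irrefl : ∀ n → (n <ᵇ n) ≡ false
<ᵇ-irrefl zero    = refl
<ᵇ-irrefl (suc n) = <ᵇ-irrefl n

<⇒<ᵇ≡true : ∀ {m n} → m < n → (m <ᵇ n) ≡ true
<⇒<ᵇ≡true m<n = Equivalence.to T-≡ (<⇒<ᵇ m<n)

<⇒≡ᵇ≡false : ∀ {m n} → m < n → (m ≡ᵇ n) ≡ false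
<⇒≡ᵇ≡false {zero}  {suc n} m<n       = refl
<⇒≡ᵇ≡false {suc m} {suc n} (s≤s m<n) = <⇒≡ᵇ≡false m<n

<⇒≡ᵇ≡false′ : ∀ {m n} → m < n → (n ≡ᵇ m) ≡ false
<⇒≡ᵇ≡false′ {zero}  {suc n} m<n       = refl
<⇒≡ᵇ≡false′ {suc m} {suc n} (s≤s m<n) = <⇒≡ᵇ≡false′ m<n

-- Relocating the arrays of a program, which frees the arrays 0, …, 4

shiftE : Expr → Expr
shiftE (const n)    = const n
shiftE (a ⟨ e ⟩)    = (5 + a) ⟨ shiftE e ⟩
shiftE (e ⟦ o ⟧ e′) = shiftE e ⟦ o ⟧ shiftE e′

shiftS : Stmt → Stmt
shiftP : Program → Program
shiftS (a ⟨ e ⟩:= e′)   = (5 + a) ⟨ shiftE e ⟩:= shiftE e′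
shiftS (a ⟨ e ⟩:=$ e′)  = (5 + a) ⟨ shiftE e ⟩:=$ shiftE e′
shiftS (ifte e s₁ s₂)   = ifte (shiftE e) (shiftP s₁) (shiftP s₂)
shiftS (while e s)      = while (shiftE e) (shiftP s)
shiftP []       = []
shiftP (s ∷ ss) = shiftS s ∷ shiftP ss

shiftP-++ : ∀ s₁ s₂ → shiftP (s₁ ++ s₂) ≡ shiftP s₁ ++ shiftP s₂
shiftP-++ []       s₂ = refl
shiftP-++ (s ∷ s₁) s₂ = cong (shiftS s ∷_) (shiftP-++ s₁ s₂)

shiftP-++-++ : ∀ s₁ s₂ post → shiftP s₁ ++ shiftP s₂ ++ post ≡ shiftP (s₁ ++ s₂) ++ post
shiftP-++-++ s₁ s₂ post = trans (sym (++-assoc (shiftP s₁) (shiftP s₂) post))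
  (cong (_++ post) (sym (shiftP-++ s₁ s₂)))

-- `ρ` is the memory that the given program would have on its own. `frame` keeps the parameters and
-- the bits `y`, which are read again once that program has ended.
record Embeds (σ₀ σ ρ : Store) : Set where
  field
    image : ∀ a i → σ (5 + a) i ≡ ρ a i
    frame : ∀ a i → a < 5 → σ a i ≡ σ₀ a i

open Embeds

eval-shift : ∀ w {σ₀ σ ρ} → Embeds σ₀ σ ρ → ∀ e → eval w σ (shiftE e) ≡ eval w ρ e
eval-shift w emb (const n)  = refl
eval-shift w {ρ = ρ} emb (a ⟨ e ⟩) = trans (image emb a _) (cong (ρ a) (eval-shift w emb e))
eval-shift w emb (e ⟦ o ⟧ e′) =
  cong₂ (λ x y → toWord w (apply w o x y)) (eval-shift w emb e) (eval-shift w emb e′)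

write-embeds : ∀ {σ₀ σ ρ} → Embeds σ₀ σ ρ → ∀ a i v →
               Embeds σ₀ (write σ (5 + a) i v) (write ρ a i v)
write-embeds {σ₀} {σ} {ρ} emb a i v = record { image = image′ ; frame = frame′ }
  where
  image′ : ∀ a′ i′ → write σ (5 + a) i v (5 + a′) i′ ≡ write ρ a i v a′ i′
  image′ a′ i′ with (a′ ≡ᵇ a) ∧ (i′ ≡ᵇ i)
  ... | true  = refl
  ... | false = image emb a′ i′
  frame′ : ∀ a′ i′ → a′ < 5 → write σ (5 + a) i v a′ i′ ≡ σ₀ a′ i′
  frame′ 0 i′ a′<5 = frame emb 0 i′ a′<5
  frame′ 1 i′ a′<5 = frame emb 1 i′ a′<5
  frame′ 2 i′ a′<5 = frame emb 2 i′ a′<5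
  frame′ 3 i′ a′<5 = frame emb 3 i′ a′<5
  frame′ 4 i′ a′<5 = frame emb 4 i′ a′<5
  frame′ (suc (suc (suc (suc (suc _))))) i′ (s≤s (s≤s (s≤s (s≤s (s≤s ())))))

module _ (w : ℕ) {C : Set} (R : Config → C → Set) {σ₀ : Store}
         (post : Program) (e : ℕ) (M : Config → Rand C)
         (continue : ∀ d σ ρ → Embeds σ₀ σ ρ → Lift R (run w (d + e) (post , σ)) (M ([] , ρ)))
         where

  -- In continuation style: whatever follows the program is supplied by `continue`, which has to
  -- accept any number `d` of unspent steps, since the program may stop early. Halting within `τ`
  -- rules out statements left over when the time is used up.
  shift-simulates : ∀ τ ss σ ρ → Embeds σ₀ σ ρ → Always Halted (run w τ (ss , ρ)) →
    Lift R (run w (τ + e) (shiftP ss ++ post , σ)) (run w τ (ss , ρ) >>= M)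
  shift-simulates zero    []       σ ρ emb halts = continue 0 σ ρ emb
  shift-simulates (suc τ) []       σ ρ emb halts rewrite run-halted w τ ρ =
    continue (suc τ) σ ρ emb
  shift-simulates (suc τ) ((a ⟨ i ⟩:= v) ∷ ss) σ ρ emb halts
    rewrite eval-shift w emb i | eval-shift w emb v =
    shift-simulates τ ss _ _ (write-embeds emb a _ _) halts
  shift-simulates (suc τ) ((a ⟨ i ⟩:=$ v) ∷ ss) σ ρ emb halts
    rewrite eval-shift w emb i | eval-shift w emb v =
    choose λ j → shift-simulates τ ss _ _ (write-embeds emb a _ _) (halts j)
  shift-simulates (suc τ) (ifte c s₁ s₂ ∷ ss) σ ρ emb halts
    rewrite eval-shift w emb c with eval w ρ c
  ... | zero  rewrite shiftP-++-++ s₂ ss post = shift-simulates τ (s₂ ++ ss) σ ρ emb halts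
  ... | suc _ rewrite shiftP-++-++ s₁ ss post = shift-simulates τ (s₁ ++ ss) σ ρ emb halts
  shift-simulates (suc τ) (while c s ∷ ss) σ ρ emb halts
    rewrite eval-shift w emb c with eval w ρ c
  ... | zero  = shift-simulates τ ss σ ρ emb halts
  ... | suc _ rewrite shiftP-++-++ s (while c s ∷ ss) post =
    shift-simulates τ (s ++ while c s ∷ ss) σ ρ emb halts

bit : Bool → ℕ
bit false = 0
bit true  = 1

-- The reduction as a program

-- Array 3 holds the loop index and the translation s, array 4 the bits y.  Arrays 5, 6 and 7
-- are arrays 0 (parameters), 1 (input words) and 2 (answer) of the relocated program.

index shiftBy count modulus target translated negated accumulated : Expr
count   = 0 ⟨ const 0 ⟩
modulus = 0 ⟨ const 1 ⟩
index   = 3 ⟨ const 0 ⟩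
shiftBy = 3 ⟨ const 1 ⟩
target  = 5 ⟨ const 2 ⟩
translated  = ((1 ⟨ index ⟩) ⟦ add ⟧ shiftBy) ⟦ rem ⟧ modulus
-- Branch-free choice between a and p - a by the bit y, as (1 - y) a + y (p - a). The remainder
-- matters when a = 0, where p - a is not reduced.
negated     = (((const 1 ⟦ sub ⟧ (4 ⟨ index ⟩)) ⟦ mul ⟧ (6 ⟨ index ⟩)) ⟦ add ⟧
               ((4 ⟨ index ⟩) ⟦ mul ⟧ (modulus ⟦ sub ⟧ (6 ⟨ index ⟩)))) ⟦ rem ⟧ modulus
accumulated = (target ⟦ add ⟧ ((4 ⟨ index ⟩) ⟦ mul ⟧ (6 ⟨ index ⟩))) ⟦ rem ⟧ modulus

loop : Program → Program
loop body = while (index ⟦ lt ⟧ count) (body ++ (3 ⟨ const 0 ⟩:= (index ⟦ add ⟧ const 1)) ∷ []) ∷ []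

maskBody unmaskBody : Program
maskBody =
  (4 ⟨ index ⟩:=$ const 2) ∷
  (6 ⟨ index ⟩:= translated) ∷
  (6 ⟨ index ⟩:= negated) ∷
  (5 ⟨ const 2 ⟩:= accumulated) ∷ []
unmaskBody =
  -- Exclusive or, as equality of one bit with the negation of the other. The comparison with 1
  -- follows `answer`, which reads every cell value other than 1 as a zero bit.
  (2 ⟨ index ⟩:= (((7 ⟨ index ⟩) ⟦ eq ⟧ const 1) ⟦ eq ⟧ ((4 ⟨ index ⟩) ⟦ eq ⟧ const 0))) ∷ []

mask : ℕ → Program
mask k =
  (5 ⟨ const 0 ⟩:= count) ∷
  (5 ⟨ const 1 ⟩:= modulus) ∷
  (3 ⟨ const 1 ⟩:=$ modulus) ∷
  (5 ⟨ const 2 ⟩:= ((const k ⟦ mul ⟧ shiftBy) ⟦ rem ⟧ modulus)) ∷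
  loop maskBody

unmask : Program
unmask = (3 ⟨ const 0 ⟩:= const 0) ∷ loop unmaskBody

reduction : ℕ → Program → Program
reduction k P = mask k ++ shiftP P ++ unmask

-- Masked instances, and facts about single cells

module _ {p : ℕ} .{{_ : NonZero p}} where

  translate : Fin p → Fin p → Fin p
  translate s x = (toℕ x + toℕ s) mod p

  negateIf : Bool → Fin p → Fin p
  negateIf b x = if b then neg x else x

  masked : ∀ {r} → Fin p → Vec Bool r → Vec (Fin p) r → Vec (Fin p) r
  masked s ys X = Vec.zipWith negateIf ys (Vec.map (translate s) X)

  maskedTarget : ∀ {r} → ℕ → Fin p → Vec Bool r → Vec (Fin p) r → Fin p
  maskedTarget k s ys X = (k * toℕ s + ∑ℕ ys (masked s ys X)) mod p

toℕ-mod : ∀ n {p} .{{_ : NonZero p}} → toℕ (n mod p) ≡ n % p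
toℕ-mod n {p} = toℕ-fromℕ< (m%n<n n p)

%-+-absorbˡ : ∀ m n p .{{_ : NonZero p}} → (m % p + n) % p ≡ (m + n) % p
%-+-absorbˡ m n p = begin
  (m % p + n) % p          ≡⟨ %-distribˡ-+ (m % p) n p ⟩
  (m % p % p + n % p) % p  ≡⟨ cong (λ x → (x + n % p) % p) (m%n%n≡m%n m p) ⟩
  (m % p + n % p) % p      ≡⟨ %-distribˡ-+ m n p ⟨
  (m + n) % p              ∎
  where open ≡-Reasoning

∑ℕ-∷ : ∀ {p r} b x (ys : Vec Bool r) (X : Vec (Fin p) r) →
       ∑ℕ (b ∷ ys) (x ∷ X) ≡ bit b * toℕ x + ∑ℕ ys X
∑ℕ-∷ false x ys X = refl
∑ℕ-∷ true  x ys X = cong (_+ ∑ℕ ys X) (sym (+-identityʳ (toℕ x)))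

xor-≡ᵇ : ∀ b c → (if (if b then 1 else 0) ≡ᵇ (if bit c ≡ᵇ 0 then 1 else 0) then 1 else 0) ≡ bit (c xor b)
xor-≡ᵇ false false = refl
xor-≡ᵇ false true  = refl
xor-≡ᵇ true  false = refl
xor-≡ᵇ true  true  = refl

tabulate-zipWith : ∀ {n} (ys : Vec Bool n) (f : Fin n → Bool) →
  Vec.tabulate (λ j → lookup ys j xor f j) ≡ Vec.zipWith _xor_ ys (Vec.tabulate f)
tabulate-zipWith []       f = refl
tabulate-zipWith (y ∷ ys) f = cong ((y xor f zero) ∷_) (tabulate-zipWith ys (f ∘ suc))

write-here : ∀ σ a i v → write σ a i v a i ≡ v
write-here σ a i v rewrite ≡ᵇ-refl a | ≡ᵇ-refl i = refl

write-before : ∀ σ a i v {j} → j < i → write σ a i v a j ≡ σ a j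
write-before σ a i v j<i rewrite ≡ᵇ-refl a | <⇒≡ᵇ≡false j<i = refl

write-after : ∀ σ a i v {j} → i < j → write σ a i v a j ≡ σ a j
write-after σ a i v i<j rewrite ≡ᵇ-refl a | <⇒≡ᵇ≡false′ i<j = refl

-- Symbolic execution without overflow

module _ (w : ℕ) where

  Fits : ℕ → Set
  Fits n = n < 2 ^ w

  toWord-fits : ∀ {n} → Fits n → toWord w n ≡ n
  toWord-fits n<2^w = m<n⇒m%n≡m {{m^n≢0 2 w}} n<2^w

  -- A derivation gives the value over the natural numbers together with the fact that no
  -- intermediate result wraps modulo `2 ^ w`.
  data Evaluates (σ : Store) : Expr → ℕ → Set where
    literal : ∀ {n} → Fits n → Evaluates σ (const n) n
    read    : ∀ {a e i v} → Evaluates σ e i → σ a i ≡ v → Evaluates σ (a ⟨ e ⟩) v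
    operate : ∀ {o e e′ x y z} → Evaluates σ e x → Evaluates σ e′ y →
              apply w o x y ≡ z → Fits z → Evaluates σ (e ⟦ o ⟧ e′) z

  eval-correct : ∀ {σ e v} → Evaluates σ e v → eval w σ e ≡ v
  eval-correct (literal n<)          = toWord-fits n<
  eval-correct {σ} (read {a} ev v≡)  = trans (cong (σ a) (eval-correct ev)) v≡
  eval-correct (operate ev ev′ z≡ z<) rewrite eval-correct ev | eval-correct ev′ | z≡ =
    toWord-fits z<

  -- A record, because run w τ c reduces and so would not determine τ and c in unification.
  record Coupled {C : Set} (R : Config → C → Set) (τ : ℕ) (c : Config) (m : Rand C) : Set where
    constructor coupled
    field lift : Lift R (run w τ c) m

  module _ {C : Set} {R : Config → C → Set} where

    run-assign : ∀ {τ σ a e e′ ss i v m} → Evaluates σ e i → Evaluates σ e′ v →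
      Coupled R τ (ss , write σ a i v) m →
      Coupled R (suc τ) ((a ⟨ e ⟩:= e′) ∷ ss , σ) m
    run-assign i≡ v≡ (coupled m) rewrite sym (eval-correct i≡) | sym (eval-correct v≡) = coupled m

    run-random : ∀ {τ σ a e e′ ss i n f} → Evaluates σ e i → Evaluates σ e′ (suc n) →
      (∀ j → Coupled R τ (ss , write σ a i (toℕ j)) (f j)) →
      Coupled R (suc τ) ((a ⟨ e ⟩:=$ e′) ∷ ss , σ) (choose (suc n) f)
    run-random {τ} {σ} {a} {e} {e′} {ss} {i} {n} {f} i≡ n≡ ms = coupled steps
      where
      steps : Lift R (run w (suc τ) ((a ⟨ e ⟩:=$ e′) ∷ ss , σ)) (choose (suc n) f)
      steps rewrite eval-correct i≡ | eval-correct n≡ = choose (Coupled.lift ∘ ms)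

    run-enter : ∀ {τ σ c s ss n m} → Evaluates σ c (suc n) →
      Coupled R τ (s ++ while c s ∷ ss , σ) m →
      Coupled R (suc τ) (while c s ∷ ss , σ) m
    run-enter {τ} {σ} {c} {s} {ss} {m = m} c≡ (coupled lift) = coupled steps
      where
      steps : Lift R (run w (suc τ) (while c s ∷ ss , σ)) m
      steps rewrite eval-correct c≡ = lift

    run-exit : ∀ {τ σ c s ss m} → Evaluates σ c 0 →
      Coupled R τ (ss , σ) m →
      Coupled R (suc τ) (while c s ∷ ss , σ) m
    run-exit {τ} {σ} {c} {s} {ss} {m} c≡ (coupled lift) = coupled steps
      where
      steps : Lift R (run w (suc τ) (while c s ∷ ss , σ)) m
      steps rewrite eval-correct c≡ = lift

-- The cells that the masking loop may change.
touched : ℕ → ℕ → Bool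
touched 3 _ = true
touched 4 _ = true
touched 5 2 = true
touched 6 _ = true
touched _ _ = false

-- The writes are nested in the order in which the loop body performs them, so the store that `run`
-- reaches after one round is this term by computation.
afterMask : Store → (i v a a′ t : ℕ) → Store
afterMask σ i v a a′ t =
  write (write (write (write (write σ 4 i v) 6 i a) 6 i a′) 5 2 t) 3 0 (suc i)

afterMask-frame : ∀ σ i v a a′ t b j → touched b j ≡ false → afterMask σ i v a a′ t b j ≡ σ b j
afterMask-frame σ i v a a′ t 0 j un = refl
afterMask-frame σ i v a a′ t 1 j un = refl
afterMask-frame σ i v a a′ t 2 j un = refl
afterMask-frame σ i v a a′ t 5 0 un = refl
afterMask-frame σ i v a a′ t 5 1 un = refl
afterMask-frame σ i v a a′ t 5 (suc (suc (suc j))) un = refl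
afterMask-frame σ i v a a′ t (suc (suc (suc (suc (suc (suc (suc b))))))) j un = refl

-- Correctness of the masking and unmasking loops

module _ (w r k p-1 : ℕ) (2≤p : 2 ≤ suc p-1) (k<p : k < suc p-1)
         (fits : ∀ {n} → n < suc p-1 * suc p-1 → Fits w n) (fits-r : ∀ {n} → n ≤ r → Fits w n)
         where

  private
    p = suc p-1

    -- Products of two residues are below `p * p`; because of `2 ≤ p`, sums of two residues are as
    -- well. One bound thus serves all arithmetic modulo `p`, and only the loop index needs
    -- `fits-r`.
    2p≤p² : p + p ≤ p * p
    2p≤p² = ≤-trans (≤-reflexive (cong (p +_) (sym (+-identityʳ p)))) (*-monoˡ-≤ p 2≤p)

    fits-p : ∀ {n} → n ≤ p → Fits w n
    fits-p n≤p = fits (<-≤-trans (≤-<-trans n≤p (m<m+n p z<s)) 2p≤p²)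

    fits-2p : ∀ {m n} → m ≤ p → n < p → Fits w (m + n)
    fits-2p m≤p n<p = fits (<-≤-trans (+-mono-≤-< m≤p n<p) 2p≤p²)

    fits-2 : Fits w 2
    fits-2 = fits-p 2≤p

    fits-1 : Fits w 1
    fits-1 = <-trans (s≤s (s≤s z≤n)) fits-2

    fits-0 : Fits w 0
    fits-0 = <-trans z<s fits-1

    fits-bit : ∀ b → Fits w (if b then 1 else 0)
    fits-bit false = fits-0
    fits-bit true  = fits-1

  module _ (σ : Store) {i : ℕ} (count≡ : σ 0 0 ≡ r) (index≡ : σ 3 0 ≡ i) where

    eval-index : Evaluates w σ index i
    eval-index = read (literal fits-0) index≡

    eval-guard : ∀ {b} → (i <ᵇ r) ≡ b → Evaluates w σ (index ⟦ lt ⟧ count) (if b then 1 else 0)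
    eval-guard {b} i<ᵇr = operate eval-index (read (literal fits-0) count≡)
      (cong (if_then 1 else 0) i<ᵇr) (fits-bit b)

    eval-increment : i < r → Evaluates w σ (index ⟦ add ⟧ const 1) (suc i)
    eval-increment i<r = operate eval-index (literal fits-1) (+-comm i 1) (fits-r i<r)

  -- The loop invariant before round `i`, where `X` is the part of the input still to be read.
  -- `output≡` is carried along because the relocated program must find zeros behind its last word.
  record Masking (s : Fin p) (σ : Store) (i : ℕ) {n} (X : Vec (Fin p) n) (t : ℕ) : Set where
    field
      count≡   : σ 0 0 ≡ r
      modulus≡ : σ 0 1 ≡ p
      index≡   : σ 3 0 ≡ i
      shiftBy≡ : σ 3 1 ≡ toℕ s
      target≡  : σ 5 2 ≡ t
      target<  : t < p
      input≡   : ∀ j → σ 1 (i + j) ≡ cell 0 (words X) j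
      output≡  : ∀ j → σ 6 (i + j) ≡ 0

  -- The effect of the remaining rounds, relative to the store `σ` at round `i`. `touched` gives up
  -- arrays 4 and 6 entirely, so the cells written by earlier rounds need `before₄` and `before₆`.
  record Masked (s : Fin p) (σ σ′ : Store) (i : ℕ) {n} (X : Vec (Fin p) n) (t : ℕ) (ys : Vec Bool n) : Set where
    field
      unchanged : ∀ b j → touched b j ≡ false → σ′ b j ≡ σ b j
      before₄   : ∀ j → j < i → σ′ 4 j ≡ σ 4 j
      before₆   : ∀ j → j < i → σ′ 6 j ≡ σ 6 j
      bits≡     : ∀ j → σ′ 4 (i + toℕ j) ≡ bit (lookup ys j)
      words≡    : ∀ j → σ′ 6 (i + j) ≡ cell 0 (words (masked s ys X)) j
      target≡   : σ′ 5 2 ≡ (t + ∑ℕ ys (masked s ys X)) % p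

  Masking-next : ∀ {s σ i n t} {x : Fin p} {X : Vec (Fin p) n} b → Masking s σ i (x ∷ X) t →
    let a  = toℕ (translate s x)
        a′ = toℕ (negateIf b (translate s x))
        t′ = (t + bit b * a′) % p in
    Masking s (afterMask σ i (bit b) a a′ t′) (suc i) X t′
  Masking-next {s} {σ} {i} {n} {t} {x} {X} b inv = inv′
    where
    module I = Masking inv
    a  = toℕ (translate s x)
    a′ = toℕ (negateIf b (translate s x))
    t′ = (t + bit b * a′) % p
    σ₁ = afterMask σ i (bit b) a a′ t′
    inv′ : Masking s σ₁ (suc i) X t′
    inv′ = record
      { count≡   = I.count≡
      ; modulus≡ = I.modulus≡
      ; index≡   = refl
      ; shiftBy≡ = I.shiftBy≡
      ; target≡  = refl
      ; target<  = m%n<n (t + bit b * a′) p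
      ; input≡   = λ j → trans (cong (σ 1) (sym (+-suc i j))) (I.input≡ (suc j))
      ; output≡  = λ j → trans (write-after (write σ₄ 6 i a) 6 i a′ (s≤s (m≤m+n i j)))
                          (trans (write-after σ₄ 6 i a (s≤s (m≤m+n i j)))
                          (trans (cong (σ 6) (sym (+-suc i j))) (I.output≡ (suc j))))
      }
      where σ₄ = write σ 4 i (bit b)

  Masked-∷ : ∀ {s σ σ′ i n t} {x : Fin p} {X : Vec (Fin p) n} b {ys : Vec Bool n} →
    let a  = toℕ (translate s x)
        a′ = toℕ (negateIf b (translate s x))
        t′ = (t + bit b * a′) % p in
    Masked s (afterMask σ i (bit b) a a′ t′) σ′ (suc i) X t′ ys →
    Masked s σ σ′ i (x ∷ X) t (b ∷ ys)
  Masked-∷ {s} {σ} {σ′} {i} {n} {t} {x} {X} b {ys} = done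
    where
    a  = toℕ (translate s x)
    a′ = toℕ (negateIf b (translate s x))
    t′ = (t + bit b * a′) % p
    done : Masked s (afterMask σ i (bit b) a a′ t′) σ′ (suc i) X t′ ys → Masked s σ σ′ i (x ∷ X) t (b ∷ ys)
    done tail = record
      { unchanged = λ c j un → trans (T.unchanged c j un)
                                     (afterMask-frame σ i (bit b) a a′ t′ c j un)
      ; before₄   = λ j j<i → trans (T.before₄ j (m<n⇒m<1+n j<i)) (write-before σ 4 i (bit b) j<i)
      ; before₆   = λ j j<i → trans (T.before₆ j (m<n⇒m<1+n j<i))
                      (trans (write-before (write σ₄ 6 i a) 6 i a′ j<i) (write-before σ₄ 6 i a j<i))
      ; bits≡     = bits
      ; words≡    = wrds
      ; target≡   = trans T.target≡ (begin
          ((t + bit b * a′) % p + ∑ℕ ys (masked s ys X)) % p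
            ≡⟨ %-+-absorbˡ (t + bit b * a′) (∑ℕ ys (masked s ys X)) p ⟩
          (t + bit b * a′ + ∑ℕ ys (masked s ys X)) % p
            ≡⟨ cong (_% p) (+-assoc t (bit b * a′) _) ⟩
          (t + (bit b * a′ + ∑ℕ ys (masked s ys X))) % p
            ≡⟨ cong (λ z → (t + z) % p) (∑ℕ-∷ b (negateIf b (translate s x)) ys (masked s ys X)) ⟨
          (t + ∑ℕ (b ∷ ys) (masked s (b ∷ ys) (x ∷ X))) % p ∎)
      }
      where
      module T = Masked tail
      open ≡-Reasoning
      σ₄ = write σ 4 i (bit b)
      bits : ∀ j → σ′ 4 (i + toℕ j) ≡ bit (lookup (b ∷ ys) j)
      bits zero    = trans (cong (σ′ 4) (+-identityʳ i))
        (trans (T.before₄ i ≤-refl) (write-here σ 4 i (bit b)))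
      bits (suc j) = trans (cong (σ′ 4) (+-suc i (toℕ j))) (T.bits≡ j)
      wrds : ∀ j → σ′ 6 (i + j) ≡ cell 0 (words (masked s (b ∷ ys) (x ∷ X))) j
      wrds zero    = trans (cong (σ′ 6) (+-identityʳ i))
        (trans (T.before₆ i ≤-refl) (write-here (write σ₄ 6 i a) 6 i a′))
      wrds (suc j) = trans (cong (σ′ 6) (+-suc i j)) (T.words≡ j)

  negateIf-value : ∀ b (x : Fin p) →
    ((1 ∸ bit b) * toℕ x + bit b * (p ∸ toℕ x)) % p ≡ toℕ (negateIf b x)
  negateIf-value false x = trans (cong (_% p) (trans (+-identityʳ (1 * toℕ x)) (*-identityˡ (toℕ x))))
    (m<n⇒m%n≡m (toℕ<n x))
  negateIf-value true  x = trans (cong (_% p) (*-identityˡ (p ∸ toℕ x))) (sym (toℕ-mod (p ∸ toℕ x)))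

  bit*≤ : ∀ b {m n} → m ≤ n → bit b * m ≤ n
  bit*≤ false     m≤n = z≤n
  bit*≤ true  {m} m≤n = ≤-trans (≤-reflexive (*-identityˡ m)) m≤n

  combine≤ : ∀ b {m n} → m ≤ p → n ≤ p → (1 ∸ bit b) * m + bit b * n ≤ p
  combine≤ false {m} m≤p n≤p =
    ≤-trans (≤-reflexive (trans (+-identityʳ (1 * m)) (*-identityˡ m))) m≤p
  combine≤ true  {n = n} m≤p n≤p = ≤-trans (≤-reflexive (*-identityˡ n)) n≤p

  module _ {C : Set} {R : Config → C → Set} {rest : Program} where

    -- The part of a round after the coin has shown `b`. A round costs six steps: the guard, the
    -- coin, and the four assignments treated here.
    maskStep : ∀ {s σ i n t τ m} {x : Fin p} {X : Vec (Fin p) n} b → i < r →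
      Masking s σ i (x ∷ X) t →
      let a  = toℕ (translate s x)
          a′ = toℕ (negateIf b (translate s x)) in
      Coupled w R τ (loop maskBody ++ rest , afterMask σ i (bit b) a a′ ((t + bit b * a′) % p)) m →
      Coupled w R (4 + τ) (List.drop 1 maskBody ++ (3 ⟨ const 0 ⟩:= (index ⟦ add ⟧ const 1)) ∷
                           loop maskBody ++ rest , write σ 4 i (bit b)) m
    maskStep {s} {σ} {i} {n} {t} {τ} {m} {x} {X} b i<r inv lift =
      run-assign w (eval-index σ₁ I.count≡ I.index≡) x+s%p≡
      (run-assign w (eval-index σ₂ I.count≡ I.index≡) negated≡
      (run-assign w (literal fits-2) target≡
      (run-assign w (literal fits-0) (eval-increment σ₄ I.count≡ I.index≡ i<r) lift)))
      where
      module I = Masking inv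
      a  = toℕ (translate s x)
      a′ = toℕ (negateIf b (translate s x))
      σ₁ = write σ 4 i (bit b)
      σ₂ = write σ₁ 6 i a
      σ₃ = write σ₂ 6 i a′
      σ₄ = write σ₃ 5 2 ((t + bit b * a′) % p)
      a≤p : a ≤ p
      a≤p = <⇒≤ (toℕ<n (translate s x))
      a′<p : a′ < p
      a′<p = toℕ<n (negateIf b (translate s x))
      x+s%p≡ : Evaluates w σ₁ translated a
      x+s%p≡ = operate
        (operate (read (eval-index σ₁ I.count≡ I.index≡)
                       (trans (cong (σ 1) (sym (+-identityʳ i))) (I.input≡ 0)))
                 (read (literal fits-1) I.shiftBy≡) refl
                 (fits-2p (<⇒≤ (toℕ<n x)) (toℕ<n s)))
        (read (literal fits-1) I.modulus≡)
        (sym (toℕ-mod (toℕ x + toℕ s))) (fits-p a≤p)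
      bit≡ : Evaluates w σ₂ (4 ⟨ index ⟩) (bit b)
      bit≡ = read (eval-index σ₂ I.count≡ I.index≡) (write-here σ 4 i (bit b))
      a≡ : Evaluates w σ₂ (6 ⟨ index ⟩) a
      a≡ = read (eval-index σ₂ I.count≡ I.index≡) (write-here σ₁ 6 i a)
      1∸bit≤1 : ∀ b → 1 ∸ bit b ≤ 1
      1∸bit≤1 b = m∸n≤m 1 (bit b)
      negated≡ : Evaluates w σ₂ negated a′
      negated≡ = operate
        (operate
          (operate (operate (literal fits-1) bit≡ refl
                      (≤-<-trans (1∸bit≤1 b) fits-1))
                   a≡ refl
                   (fits-p (≤-trans (m≤m+n ((1 ∸ bit b) * a) (bit b * (p ∸ a))) both≤)))
          (operate bit≡ (operate (read (literal fits-1) I.modulus≡) a≡ refl (fits-p (m∸n≤m p a)))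
                   refl (fits-p (bit*≤ b (m∸n≤m p a))))
          refl (fits-p both≤))
        (read (literal fits-1) I.modulus≡)
        (negateIf-value b (translate s x)) (fits-p (<⇒≤ a′<p))
        where
        both≤ : (1 ∸ bit b) * a + bit b * (p ∸ a) ≤ p
        both≤ = combine≤ b a≤p (m∸n≤m p a)
      target≡ : Evaluates w σ₃ accumulated ((t + bit b * a′) % p)
      target≡ = operate
        (operate (read (literal fits-2) I.target≡)
          (operate (read (eval-index σ₃ I.count≡ I.index≡) (write-here σ 4 i (bit b)))
                   (read (eval-index σ₃ I.count≡ I.index≡) (write-here σ₂ 6 i a′)) refl
                   (fits-p (bit*≤ b (<⇒≤ a′<p))))
          refl (subst (Fits w) (+-comm (bit b * a′) t) (fits-2p (bit*≤ b (<⇒≤ a′<p)) I.target<)))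
        (read (literal fits-1) I.modulus≡) refl (fits-p (<⇒≤ (m%n<n (t + bit b * a′) p)))

    run-mask : ∀ {s e} n (X : Vec (Fin p) n) σ i t (M : Vec Bool n → Rand C) →
      i + n ≡ r → Masking s σ i X t →
      (∀ ys σ′ → Masked s σ σ′ i X t ys → Coupled w R e (rest , σ′) (M ys)) →
      Coupled w R (n * 6 + suc e) (loop maskBody ++ rest , σ) (iid coin n >>= M)
    run-mask zero [] σ i t M refl inv continue =
      run-exit w (eval-guard σ I.count≡ I.index≡ (trans (cong (i <ᵇ_) (+-identityʳ i)) (<ᵇ-irrefl i)))
        (continue [] σ record
          { unchanged = λ _ _ _ → refl
          ; before₄   = λ _ _ → refl
          ; before₆   = λ _ _ → refl
          ; bits≡     = λ ()
          ; words≡    = I.output≡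
          ; target≡   = trans I.target≡ (sym (trans (cong (_% p) (+-identityʳ t)) (m<n⇒m%n≡m I.target<)))
          })
      where module I = Masking inv
    run-mask {s} {e} (suc n) (x ∷ X) σ i t M refl inv continue =
      run-enter w (eval-guard σ I.count≡ I.index≡ (<⇒<ᵇ≡true i<r))
        (run-random w (eval-index σ I.count≡ I.index≡) (literal fits-2)
          -- The drawn words 0 and 1 are the positions of `false` and `true` in the list behind
          -- `coin`.
          λ { zero → next false ; (suc zero) → next true })
      where
      module I = Masking inv
      i<r : i < r
      i<r = m<m+n i z<s
      next : ∀ b → Coupled w R (4 + (n * 6 + suc e))
        (List.drop 1 maskBody ++ (3 ⟨ const 0 ⟩:= (index ⟦ add ⟧ const 1)) ∷ loop maskBody ++ rest ,
         write σ 4 i (bit b))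
        (iid coin n >>= (λ ys → return (b ∷ ys)) >>= M)
      next b = maskStep b i<r inv (coupled (Lift-assoc (iid coin n) (Coupled.lift
        (run-mask n X _ (suc i) _ (λ ys → M (b ∷ ys)) (sym (+-suc i n)) (Masking-next b inv)
          λ ys σ′ tail → continue (b ∷ ys) σ′ (Masked-∷ b tail)))))

  record Unmasking (σ : Store) (i : ℕ) {n} (ys : Vec Bool n) : Set where
    field
      count≡ : σ 0 0 ≡ r
      index≡ : σ 3 0 ≡ i
      bits≡  : ∀ j → σ 4 (i + toℕ j) ≡ bit (lookup ys j)

  record Unmasked (σ σ′ : Store) (i : ℕ) {n} (ys : Vec Bool n) : Set where
    field
      before₂ : ∀ j → j < i → σ′ 2 j ≡ σ 2 j
      answer≡ : ∀ j → (σ′ 2 (i + toℕ j) ≡ᵇ 1) ≡ lookup ys j xor (σ 7 (i + toℕ j) ≡ᵇ 1)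

  bit≡ᵇ1 : ∀ b → (bit b ≡ᵇ 1) ≡ b
  bit≡ᵇ1 false = refl
  bit≡ᵇ1 true  = refl

  fits-bit′ : ∀ b → Fits w (bit b)
  fits-bit′ false = fits-0
  fits-bit′ true  = fits-1

  run-unmask : ∀ {C : Set} {R : Config → C → Set} {e m} n (ys : Vec Bool n) σ i → i + n ≡ r →
    Unmasking σ i ys →
    (∀ σ′ → Unmasked σ σ′ i ys → Lift R (return ([] , σ′)) m) →
    Coupled w R (n * 3 + suc e) (loop unmaskBody , σ) m
  run-unmask {R = R} {e} {m} zero [] σ i refl inv continue =
    run-exit w (eval-guard σ I.count≡ I.index≡ (trans (cong (i <ᵇ_) (+-identityʳ i)) (<ᵇ-irrefl i)))
      (coupled (subst (λ c → Lift R c m) (sym (run-halted w e σ))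
        (continue σ record { before₂ = λ _ _ → refl ; answer≡ = λ () })))
    where module I = Unmasking inv
  run-unmask (suc n) (y ∷ ys) σ i refl inv continue =
    run-enter w (eval-guard σ I.count≡ I.index≡ (<⇒<ᵇ≡true i<r))
      (run-assign w (eval-index σ I.count≡ I.index≡) answerBit
      (run-assign w (literal fits-0) (eval-increment σ₁ I.count≡ I.index≡ i<r)
      (run-unmask n ys σ₂ (suc i) (sym (+-suc i n)) inv′ λ σ′ tail → continue σ′ (done tail))))
    where
    module I = Unmasking inv
    i<r : i < r
    i<r = m<m+n i z<s
    z = σ 7 i ≡ᵇ 1
    σ₁ = write σ 2 i (bit (y xor z))
    σ₂ = write σ₁ 3 0 (suc i)
    answerBit : Evaluates w σ
      (((7 ⟨ index ⟩) ⟦ eq ⟧ const 1) ⟦ eq ⟧ ((4 ⟨ index ⟩) ⟦ eq ⟧ const 0)) (bit (y xor z))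
    answerBit = operate
      (operate (read (eval-index σ I.count≡ I.index≡) refl) (literal fits-1) refl (fits-bit z))
      (operate (read (eval-index σ I.count≡ I.index≡)
                     (trans (cong (σ 4) (sym (+-identityʳ i))) (I.bits≡ zero)))
               (literal fits-0) refl (fits-bit (bit y ≡ᵇ 0)))
      (xor-≡ᵇ z y) (fits-bit′ (y xor z))
    inv′ : Unmasking σ₂ (suc i) ys
    inv′ = record
      { count≡ = I.count≡
      ; index≡ = refl
      ; bits≡  = λ j → trans (cong (σ 4) (sym (+-suc i (toℕ j)))) (I.bits≡ (suc j))
      }
    done : ∀ {σ′} → Unmasked σ₂ σ′ (suc i) ys → Unmasked σ σ′ i (y ∷ ys)
    done {σ′} tail = record
      { before₂ = λ j j<i → trans (T.before₂ j (m<n⇒m<1+n j<i)) (write-before σ 2 i (bit (y xor z)) j<i)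
      ; answer≡ = answer′
      }
      where
      module T = Unmasked tail
      answer′ : ∀ j → (σ′ 2 (i + toℕ j) ≡ᵇ 1) ≡ lookup (y ∷ ys) j xor (σ 7 (i + toℕ j) ≡ᵇ 1)
      answer′ zero rewrite +-identityʳ i = trans
        (cong (_≡ᵇ 1) (trans (T.before₂ i ≤-refl) (write-here σ 2 i (bit (y xor z)))))
        (bit≡ᵇ1 (y xor z))
      answer′ (suc j) rewrite +-suc i (toℕ j) = T.answer≡ j

  -- The outcome relation of the coupling: a final configuration of the reduction against the bits
  -- `y` and the final configuration of the subset-sum run inside it.
  record Recovers (c : Config) (ysc′ : Vec Bool r × Config) : Set where
    field
      halts   : Halted c
      answer≡ : answer c ≡ Vec.zipWith _xor_ (proj₁ ysc′) (answer (proj₂ ysc′))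

  -- The given program is arbitrary and may read cells outside its input, so the embedded memory
  -- must agree with the prescribed one everywhere, zeros included.
  instance-start : ∀ {s σ₀ σ′} {X : Vec (Fin p) r} {ys : Vec Bool r} →
    σ₀ 5 0 ≡ r → σ₀ 5 1 ≡ p → (∀ j → σ₀ 5 (3 + j) ≡ 0) → (∀ a i → σ₀ (7 + a) i ≡ 0) →
    Masked s σ₀ σ′ 0 X ((k * toℕ s) % p) ys →
    Embeds σ′ σ′ (memory (subsetSumInput (masked s ys X) (maskedTarget k s ys X)))
  instance-start {s} {σ₀} {σ′} {X} {ys} r≡ p≡ beyond later md = record
    { image = image′ ; frame = λ _ _ _ → refl }
    where
    module M = Masked md
    image′ : ∀ a i → σ′ (5 + a) i ≡ memory (subsetSumInput (masked s ys X) (maskedTarget k s ys X)) a i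
    image′ 0 0 = trans (M.unchanged 5 0 refl) r≡
    image′ 0 1 = trans (M.unchanged 5 1 refl) p≡
    image′ 0 2 = trans M.target≡ (trans (%-+-absorbˡ (k * toℕ s) (∑ℕ ys (masked s ys X)) p)
                   (sym (toℕ-mod (k * toℕ s + ∑ℕ ys (masked s ys X)))))
    image′ 0 (suc (suc (suc j))) = trans (M.unchanged 5 (3 + j) refl) (beyond j)
    image′ 1 j = M.words≡ j
    image′ (suc (suc a)) j = trans (M.unchanged (7 + a) j refl) (later a j)

  -- Stated for every `X`, planted or not, because halting is required on all inputs. The time
  -- consists of 4 steps for the copied parameters, `s` and the initial target; `6 r + 1` for
  -- masking; `τ` for the given program; 1 for resetting the index; `3 r + 1` for unmasking; and `e`
  -- spare steps.
  reduction-simulates : ∀ P τ e → (X : Vec (Fin p) r) →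
    (∀ A t → Always Halted (run w τ (start P (subsetSumInput {p} {r} A t)))) →
    Coupled w Recovers
      (4 + (r * 6 + suc (τ + suc (r * 3 + suc e)))) (start (reduction k P) (kSumInput X))
      (uniform p >>= λ s → iid coin r >>= λ ys →
       run w τ (start P (subsetSumInput (masked s ys X) (maskedTarget k s ys X))) >>= λ c → return (ys , c))
  reduction-simulates P τ e X halts =
    run-assign w (literal fits-0) (read (literal fits-0) refl)
    (run-assign w (literal fits-1) (read (literal fits-1) refl)
    (run-random w (literal fits-1) (read (literal fits-1) refl) λ s →
     run-assign w (literal fits-2) (operate (operate (literal (fits-p (<⇒≤ k<p))) (read (literal fits-1) refl) refl
         (fits (*-mono-< k<p (toℕ<n s)))) (read (literal fits-1) refl) refl (fits-p (<⇒≤ (m%n<n (k * toℕ s) p))))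
    (run-mask r X _ 0 ((k * toℕ s) % p) _ refl
       (record { count≡ = refl ; modulus≡ = refl ; index≡ = refl ; shiftBy≡ = refl ; target≡ = refl
               ; target< = m%n<n (k * toℕ s) p ; input≡ = λ _ → refl ; output≡ = λ _ → refl })
       λ ys σ′ md → coupled (shift-simulates w _ unmask (suc (r * 3 + suc e)) _
         (λ d σ ρ emb → Coupled.lift (unmasks ys d σ ρ emb (Masked.bits≡ md) (Masked.unchanged md 0 0 refl)))
         τ P σ′ _ (instance-start refl refl (λ _ → refl) (λ _ _ → refl) md) (halts _ _)))))
    where
    unmasks : ∀ ys d σ ρ {σ₀} → Embeds σ₀ σ ρ → (∀ j → σ₀ 4 (toℕ j) ≡ bit (lookup ys j)) → σ₀ 0 0 ≡ r →
      Coupled w Recovers (d + suc (r * 3 + suc e)) (unmask , σ) (return (ys , ([] , ρ)))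
    unmasks ys d σ ρ {σ₀} emb bits≡ count≡ = subst
      (λ τ → Coupled w Recovers τ (unmask , σ) (return (ys , ([] , ρ)))) budget
      (run-assign w {τ = r * 3 + suc (d + e)} (literal fits-0) (literal fits-0)
        (run-unmask r ys (write σ 3 0 0) 0 refl
          (record { count≡ = trans (emb .Embeds.frame 0 0 z<s) count≡ ; index≡ = refl
                  ; bits≡ = λ j → trans (emb .Embeds.frame 4 (toℕ j) ≤-refl) (bits≡ j) })
          λ σ′ done → return (record { halts = refl ; answer≡ = answers σ′ (Unmasked.answer≡ done) })))
      where
      budget : suc (r * 3 + suc (d + e)) ≡ d + suc (r * 3 + suc e)
      budget = begin
        suc (r * 3 + suc (d + e))  ≡⟨ cong (λ x → suc (r * 3 + x)) (+-suc d e) ⟨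
        suc (r * 3 + (d + suc e))  ≡⟨ cong suc (+-assoc (r * 3) d (suc e)) ⟨
        suc (r * 3 + d + suc e)    ≡⟨ cong (λ x → suc (x + suc e)) (+-comm (r * 3) d) ⟩
        suc (d + r * 3 + suc e)    ≡⟨ cong suc (+-assoc d (r * 3) (suc e)) ⟩
        suc (d + (r * 3 + suc e))  ≡⟨ +-suc d (r * 3 + suc e) ⟨
        d + suc (r * 3 + suc e)    ∎
        where open ≡-Reasoning
      answers : ∀ σ′ → (∀ j → (σ′ 2 (toℕ j) ≡ᵇ 1) ≡ lookup ys j xor (σ 7 (toℕ j) ≡ᵇ 1)) →
                answer {r} ([] , σ′) ≡ Vec.zipWith _xor_ ys (answer {r} ([] , ρ))
      answers σ′ eqs = trans
        (tabulate-cong (λ j → trans (eqs j) (cong (λ v → lookup ys j xor (v ≡ᵇ 1)) (emb .Embeds.image 2 (toℕ j)))))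
        (tabulate-zipWith ys (λ j → ρ 2 (toℕ j) ≡ᵇ 1))

-- Planted subsets and exclusive or

infix 4 _≟ᵇ_
_≟ᵇ_ : ∀ {r} (x z : Vec Bool r) → _
_≟ᵇ_ = ≡-decᵛ Bool._≟_

min-inside : ∀ {r k} (S : Subset r) → ∣ S ∣ ≡ suc k → ∃ λ i → min S ≡ just i × lookup S i ≡ true
min-inside (inside  ∷ S) size = zero , refl , refl
min-inside (outside ∷ S) size with i , min≡ , i∈S ← min-inside S size =
  suc i , cong (Maybe.map suc) min≡ , i∈S

size-remove : ∀ {r} (S : Subset r) i → lookup S i ≡ true → ∣ S ∣ ≡ suc ∣ S - i ∣
size-remove (inside  ∷ S) zero    i∈S = cong (suc ∘ ∣_∣) (sym (p─⊥≡p S))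
size-remove (inside  ∷ S) (suc i) i∈S = cong suc (size-remove S i i∈S)
size-remove (outside ∷ S) (suc i) i∈S = size-remove S i i∈S

∑ℕ-update : ∀ {p r} (S : Subset r) i (X : Vec (Fin p) r) v → lookup S i ≡ true →
            ∑ℕ S (X Vec.[ i ]≔ v) ≡ toℕ v + ∑ℕ (S - i) X
∑ℕ-update (inside  ∷ S) zero    (x ∷ X) v i∈S = cong (λ S → toℕ v + ∑ℕ S X) (sym (p─⊥≡p S))
∑ℕ-update (outside ∷ S) (suc i) (x ∷ X) v i∈S = ∑ℕ-update S i X v i∈S
∑ℕ-update (inside  ∷ S) (suc i) (x ∷ X) v i∈S = begin
  toℕ x + ∑ℕ S (X Vec.[ i ]≔ v)      ≡⟨ cong (toℕ x +_) (∑ℕ-update S i X v i∈S) ⟩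
  toℕ x + (toℕ v + ∑ℕ (S - i) X)     ≡⟨ +-assoc (toℕ x) (toℕ v) _ ⟨
  toℕ x + toℕ v + ∑ℕ (S - i) X       ≡⟨ cong (_+ ∑ℕ (S - i) X) (+-comm (toℕ x) (toℕ v)) ⟩
  toℕ v + toℕ x + ∑ℕ (S - i) X       ≡⟨ +-assoc (toℕ v) (toℕ x) _ ⟩
  toℕ v + (toℕ x + ∑ℕ (S - i) X)     ∎
  where open ≡-Reasoning

xor-cancelˡ : ∀ {r} (ys S : Vec Bool r) → Vec.zipWith _xor_ ys (Vec.zipWith _xor_ ys S) ≡ S
xor-cancelˡ []       []      = refl
xor-cancelˡ (y ∷ ys) (b ∷ S) = cong₂ _∷_
  (trans (sym (xor-assoc y y b)) (cong (_xor b) (xor-same y))) (xor-cancelˡ ys S)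

x+[y+z] : ∀ x y z → x + (y + z) ≡ y + (x + z)
x+[y+z] x y z = trans (sym (+-assoc x y z)) (trans (cong (_+ z) (+-comm x y)) (+-assoc y x z))

+-interchange : ∀ a b c d → a + b + (c + d) ≡ a + c + (b + d)
+-interchange a b c d = begin
  a + b + (c + d)    ≡⟨ +-assoc a b (c + d) ⟩
  a + (b + (c + d))  ≡⟨ cong (a +_) (x+[y+z] b c d) ⟩
  a + (c + (b + d))  ≡⟨ +-assoc a c (b + d) ⟨
  a + c + (b + d)    ∎
  where open ≡-Reasoning

-- Arithmetic modulo `p`

module Modular {p : ℕ} .{{_ : NonZero p}} where

  infix 4 _≋_
  -- A record, so that `a` and `b` can be inferred; they are not determined by their remainders.
  record _≋_ (a b : ℕ) : Set where
    constructor mod≡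
    field residues : a % p ≡ b % p

  open _≋_ public

  ≋-refl : ∀ {a} → a ≋ a
  ≋-refl = mod≡ refl

  ≋-sym : ∀ {a b} → a ≋ b → b ≋ a
  ≋-sym (mod≡ a≡b) = mod≡ (sym a≡b)

  ≋-trans : ∀ {a b c} → a ≋ b → b ≋ c → a ≋ c
  ≋-trans (mod≡ a≡b) (mod≡ b≡c) = mod≡ (trans a≡b b≡c)

  ≡⇒≋ : ∀ {a b} → a ≡ b → a ≋ b
  ≡⇒≋ refl = ≋-refl

  +-cong : ∀ {a b c d} → a ≋ b → c ≋ d → a + c ≋ b + d
  +-cong {a} {b} {c} {d} (mod≡ a≡b) (mod≡ c≡d) = mod≡ (begin
    (a + c) % p          ≡⟨ %-distribˡ-+ a c p ⟩
    (a % p + c % p) % p  ≡⟨ cong₂ (λ x y → (x + y) % p) a≡b c≡d ⟩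
    (b % p + d % p) % p  ≡⟨ %-distribˡ-+ b d p ⟨
    (b + d) % p          ∎)
    where open ≡-Reasoning

  %-≋ : ∀ a → a % p ≋ a
  %-≋ a = mod≡ (m%n%n≡m%n a p)

  p≋0 : p ≋ 0
  p≋0 = mod≡ ([m+n]%n≡m%n 0 p)

  +-cancelʳ : ∀ {a b} c → a + c ≋ b + c → a ≋ b
  +-cancelʳ {a} {b} c ac≋bc = ≋-trans (≋-sym (undo a)) (≋-trans (+-cong ac≋bc ≋-refl) (undo b))
    where
    c⁻ = p ∸ c % p
    c+c⁻≋0 : c + c⁻ ≋ 0
    c+c⁻≋0 = ≋-trans (+-cong (≋-sym (%-≋ c)) ≋-refl)
      (≋-trans (≡⇒≋ (m+[n∸m]≡n (<⇒≤ (m%n<n c p)))) p≋0)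
    undo : ∀ a → a + c + c⁻ ≋ a
    undo a = ≋-trans (≡⇒≋ (+-assoc a c c⁻))
      (≋-trans (+-cong ≋-refl c+c⁻≋0) (≡⇒≋ (+-identityʳ a)))

  +-cancelˡ : ∀ c {a b} → c + a ≋ c + b → a ≋ b
  +-cancelˡ c {a} {b} ca≋cb = +-cancelʳ c
    (≋-trans (≡⇒≋ (+-comm a c)) (≋-trans ca≋cb (≡⇒≋ (+-comm c b))))

  toℕ-mod-≋ : ∀ a → toℕ (a mod p) ≋ a
  toℕ-mod-≋ a = ≋-trans (≡⇒≋ (toℕ-mod a)) (%-≋ a)

  mod-cong : ∀ {a b} → a ≋ b → a mod p ≡ b mod p
  mod-cong {a} {b} (mod≡ a≡b) = toℕ-injective (trans (toℕ-mod a) (trans a≡b (sym (toℕ-mod b))))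

  mod-injective : ∀ {a b} → a mod p ≡ b mod p → a ≋ b
  mod-injective {a} {b} a≡b = mod≡ (trans (sym (toℕ-mod a)) (trans (cong toℕ a≡b) (toℕ-mod b)))

  toℕ-≋-injective : ∀ {x y : Fin p} → toℕ x ≋ toℕ y → x ≡ y
  toℕ-≋-injective {x} {y} (mod≡ x≡y) = toℕ-injective
    (trans (sym (m<n⇒m%n≡m (toℕ<n x))) (trans x≡y (m<n⇒m%n≡m (toℕ<n y))))

  neg-≋ : ∀ x → toℕ (neg x) + toℕ x ≋ 0
  neg-≋ x = ≋-trans (+-cong (toℕ-mod-≋ (p ∸ toℕ x)) ≋-refl)
    (≋-trans (≡⇒≋ (m∸n+n≡m (<⇒≤ (toℕ<n x)))) p≋0)

  translate-injective : ∀ s → Injective _≡_ _≡_ (translate {p} s)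
  translate-injective s {x} {y} sx≡sy = toℕ-≋-injective (+-cancelʳ (toℕ s) (mod-injective sx≡sy))

  negateIf-injective : ∀ b → Injective _≡_ _≡_ (negateIf {p} b)
  negateIf-injective false x≡y = x≡y
  negateIf-injective true {x} {y} nx≡ny = toℕ-≋-injective (+-cancelˡ (toℕ (neg x))
    (≋-trans (neg-≋ x) (≋-trans (≋-sym (neg-≋ y)) (≡⇒≋ (cong (λ z → toℕ z + toℕ y) (sym nx≡ny))))))

  affine : ℕ → Fin p → Fin p → Fin p
  affine k c s = (k * toℕ s + toℕ c) mod p

  private
    -- With `s ≤ s′` the truncated difference is the true one, and `p` divides k (s′ - s). By
    -- Euclid's lemma it divides a factor; both factors are below `p` and `k` is nonzero, so the
    -- difference vanishes. This is the role of primality and of `k < p` in the uniformity argument.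
    k*-cancel : Prime p → ∀ {k} → 1 ≤ k → k < p → ∀ {s s′ : Fin p} →
                toℕ s ≤ toℕ s′ → k * toℕ s ≋ k * toℕ s′ → s ≡ s′
    k*-cancel pr {k} 1≤k k<p {s} {s′} s≤s′ ks≋ks′ =
      case euclidsLemma k d pr (m%n≡0⇒n∣m (k * d) p (trans (residues kd≋0) (m<n⇒m%n≡m (≤-<-trans z≤n k<p)))) of λ
      { (inj₁ p∣k) → contradiction (∣⇒≤ {{>-nonZero 1≤k}} p∣k) (<⇒≱ k<p)
      ; (inj₂ p∣d) → small (d ≟ 0) p∣d }
      where
      d = toℕ s′ ∸ toℕ s
      s+d≡s′ : toℕ s + d ≡ toℕ s′
      s+d≡s′ = m+[n∸m]≡n s≤s′
      kd≋0 : k * d ≋ 0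
      kd≋0 = +-cancelˡ (k * toℕ s) (≋-trans (≡⇒≋ (sym (*-distribˡ-+ k (toℕ s) d)))
        (≋-trans (≡⇒≋ (cong (k *_) s+d≡s′)) (≋-trans (≋-sym ks≋ks′) (≡⇒≋ (sym (+-identityʳ (k * toℕ s)))))))
      small : Dec (d ≡ 0) → p ∣ d → s ≡ s′
      small (yes d≡0) p∣d = toℕ-injective
        (trans (sym (+-identityʳ (toℕ s))) (trans (cong (toℕ s +_) (sym d≡0)) s+d≡s′))
      small (no  d≢0) p∣d = contradiction (∣⇒≤ {{≢-nonZero d≢0}} p∣d)
        (<⇒≱ (≤-<-trans (m∸n≤m (toℕ s′) (toℕ s)) (toℕ<n s′)))

  affine-injective : Prime p → ∀ {k} → 1 ≤ k → k < p → ∀ c → Injective _≡_ _≡_ (affine k c)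
  affine-injective pr {k} 1≤k k<p c {s} {s′} eqs with ≤-total (toℕ s) (toℕ s′)
  ... | inj₁ s≤s′ = k*-cancel pr 1≤k k<p s≤s′ (+-cancelʳ (toℕ c) (mod-injective eqs))
  ... | inj₂ s′≤s = sym (k*-cancel pr 1≤k k<p s′≤s (+-cancelʳ (toℕ c) (mod-injective (sym eqs))))

  ∑ℕ-translate : ∀ {r} (S : Subset r) s X → ∑ℕ S (Vec.map (translate s) X) ≋ ∑ℕ S X + ∣ S ∣ * toℕ s
  ∑ℕ-translate []            s []      = ≋-refl
  ∑ℕ-translate (outside ∷ S) s (x ∷ X) = ∑ℕ-translate S s X
  ∑ℕ-translate (inside  ∷ S) s (x ∷ X) = ≋-trans
    (+-cong (toℕ-mod-≋ (toℕ x + toℕ s)) (∑ℕ-translate S s X))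
    (≡⇒≋ (+-interchange (toℕ x) (toℕ s) (∑ℕ S X) (∣ S ∣ * toℕ s)))

  plant-solves : ∀ {r} (S : Subset r) X {i} → min S ≡ just i → lookup S i ≡ true →
                 ∑ℕ S (plant S X) ≋ 0
  plant-solves S X {i} min≡ i∈S rewrite min≡ = ≋-trans (≡⇒≋ (∑ℕ-update S i X _ i∈S))
    (≋-trans (+-cong ≋-refl (≋-sym (toℕ-mod-≋ (∑ℕ (S - i) X)))) (neg-≋ (∑[ S - i ] X)))

  -- The planted coordinate of the translate is determined by the others through the
  -- condition that the coordinates in S sum to k s, hence is uniform when s is.
  translate-plant : ∀ {r k} (S : Subset r) X s {i} → min S ≡ just i → lookup S i ≡ true → ∣ S ∣ ≡ k →
    let Y = Vec.map (translate s) X in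
    Vec.map (translate s) (plant S X) ≡ Y Vec.[ i ]≔ affine k (neg (∑[ S - i ] Y)) s
  translate-plant {k = k} S X s {i} min≡ i∈S refl rewrite min≡ =
    -- Two expressions for coordinate `i` are compared by adding the rest of `S` to each: both
    -- totals are `∣ S ∣ * s` modulo `p`, so the rest can be cancelled.
    trans (map-[]≔ (translate s) X i) (cong (Y Vec.[ i ]≔_) (mod-cong (+-cancelʳ ΣY (≋-trans left (≋-sym right)))))
    where
    Y  = Vec.map (translate s) X
    ΣX = ∑ℕ (S - i) X
    ΣY = ∑ℕ (S - i) Y
    cancels : ∀ X → toℕ (neg (∑[ S - i ] X)) + ∑ℕ (S - i) X ≋ 0
    cancels X = ≋-trans (+-cong ≋-refl (≋-sym (toℕ-mod-≋ (∑ℕ (S - i) X)))) (neg-≋ (∑[ S - i ] X))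
    n = toℕ (neg (∑[ S - i ] X))
    left : n + toℕ s + ΣY ≋ ∣ S ∣ * toℕ s
    left = ≋-trans (+-cong (≋-refl {n + toℕ s}) (∑ℕ-translate (S - i) s X))
      (≋-trans (≡⇒≋ (+-interchange n (toℕ s) ΣX (∣ S - i ∣ * toℕ s)))
      (≋-trans (+-cong (cancels X) ≋-refl) (≡⇒≋ (cong (_* toℕ s) (sym (size-remove S i i∈S))))))
    right : ∣ S ∣ * toℕ s + toℕ (neg (∑[ S - i ] Y)) + ΣY ≋ ∣ S ∣ * toℕ s
    right = ≋-trans (≡⇒≋ (+-assoc (∣ S ∣ * toℕ s) _ ΣY))
      (≋-trans (+-cong ≋-refl (cancels Y)) (≡⇒≋ (+-identityʳ _)))

  -- Negating the coordinates in ys while flipping the membership bits of ys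
  -- changes the subset sum by the constant ∑_{ys} A.
  ∑ℕ-xor : ∀ {r} (ys S : Vec Bool r) (A : Vec (Fin p) r) →
    let A′ = Vec.zipWith negateIf ys A in
    ∑ℕ S A + ∑ℕ ys A′ ≋ ∑ℕ (Vec.zipWith _xor_ ys S) A′
  ∑ℕ-xor []           []          []      = ≋-refl
  ∑ℕ-xor (false ∷ ys) (false ∷ S) (a ∷ A) = ∑ℕ-xor ys S A
  ∑ℕ-xor (false ∷ ys) (true  ∷ S) (a ∷ A) =
    ≋-trans (≡⇒≋ (+-assoc (toℕ a) (∑ℕ S A) _)) (+-cong ≋-refl (∑ℕ-xor ys S A))
  ∑ℕ-xor (true  ∷ ys) (false ∷ S) (a ∷ A) = ≋-trans (≡⇒≋ (x+[y+z] (∑ℕ S A) (toℕ (neg a)) _))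
    (+-cong ≋-refl (∑ℕ-xor ys S A))
  ∑ℕ-xor (true  ∷ ys) (true  ∷ S) (a ∷ A) =
    ≋-trans (≡⇒≋ (+-interchange (toℕ a) (∑ℕ S A) (toℕ (neg a)) _))
      (≋-trans (+-cong (≋-trans (≡⇒≋ (+-comm (toℕ a) (toℕ (neg a)))) (neg-≋ a)) ≋-refl)
      (∑ℕ-xor ys S A))

  maskedTarget-correct : ∀ {r k} (S : Subset r) (X : Vec (Fin p) r) s ys → ∣ S ∣ ≡ k → ∑ℕ S X ≋ 0 →
    maskedTarget k s ys X ≡ ∑[ Vec.zipWith _xor_ ys S ] (masked s ys X)
  maskedTarget-correct {k = k} S X s ys refl ΣX≋0 = mod-cong (≋-trans
    (+-cong (≋-sym (≋-trans (∑ℕ-translate S s X) (+-cong ΣX≋0 ≋-refl))) ≋-refl)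
    (∑ℕ-xor ys S (Vec.map (translate s) X)))

  -- Collisions

  uniform-injective : ∀ {π : Fin p → Fin p} → Injective _≡_ _≡_ π → ∀ f → E (uniform p) (f ∘ π) ≡ E (uniform p) f
  uniform-injective inj f = avg-injective p inj f

  agrees : ℕ → ℕ → Bool
  agrees a b = does (a mod p ≟ᶠ b mod p)

  agrees⇒≋ : ∀ {a b} → agrees a b ≡ true → a ≋ b
  agrees⇒≋ {a} {b} ag with a mod p ≟ᶠ b mod p
  ... | yes a≡b = mod-injective a≡b

  -- The offsets `u` and `v` absorb the leading entries on which `z` and `x` agree. At the first
  -- disagreement the entry `a` occurs on one side only, so for any choice of the later entries at
  -- most one value of `a` makes the two sums agree.
  collision-≤ : ∀ {p-1} → p ≡ suc p-1 → ∀ {r} (z x : Vec Bool r) → z ≢ x → ∀ u v →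
    E (iid (uniform p) r) (λ A → indicator (agrees (u + ∑ℕ z A) (v + ∑ℕ x A))) ℚ.≤ frac 1 p-1
  collision-≤ p≡ []      []      z≢x u v = contradiction refl z≢x
  collision-≤ {p-1} refl {suc r} (b ∷ z) (c ∷ x) z≢x u v = ℚₚ.≤-trans (ℚₚ.≤-reflexive split) (case b Bool.≟ c of λ
    { (yes refl) → ℚₚ.≤-trans
        (E-mono (uniform p) (λ a →
          collision-≤ refl z x (z≢x ∘ cong (b ∷_)) (u + bit b * toℕ a) (v + bit b * toℕ a)))
        (E-const-≤ (uniform p) 0≤1/p)
    ; (no b≢c) → ℚₚ.≤-trans
        (ℚₚ.≤-reflexive (E-comm (uniform p) (iid (uniform p) r) (λ a A → indicator (agreeing a A))))
        (ℚₚ.≤-trans (E-mono (iid (uniform p) r) (λ A → avg-atMostOne {p-1} (λ a → agreeing a A)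
            (λ i j bi bj → unique b c b≢c A (agrees⇒≋ bi) (agrees⇒≋ bj))))
          (E-const-≤ (iid (uniform p) r) 0≤1/p)) })
    where
    0≤1/p : 0ℚ ℚ.≤ frac 1 p-1
    0≤1/p = ℚₚ.nonNegative⁻¹ (frac 1 p-1) {{frac-nonNeg 1 p-1}}
    agreeing : Fin p → Vec (Fin p) r → Bool
    agreeing a A = agrees (u + bit b * toℕ a + ∑ℕ z A) (v + bit c * toℕ a + ∑ℕ x A)
    regroup : ∀ u b a (z : Vec Bool r) A → u + ∑ℕ (b ∷ z) (a ∷ A) ≡ u + bit b * toℕ a + ∑ℕ z A
    regroup u b a z A = trans (cong (u +_) (∑ℕ-∷ b a z A)) (sym (+-assoc u (bit b * toℕ a) (∑ℕ z A)))
    split : E (iid (uniform p) (suc r)) (λ A → indicator (agrees (u + ∑ℕ (b ∷ z) A) (v + ∑ℕ (c ∷ x) A))) ≡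
            E (uniform p) (λ a → E (iid (uniform p) r) (λ A → indicator (agreeing a A)))
    split = trans (E-iid-∷ (uniform p) r _) (E-cong (uniform p) λ a → E-cong (iid (uniform p) r) λ A →
      cong₂ (λ l r → indicator (agrees l r)) (regroup u b a z A) (regroup v c a x A))
    solve : ∀ {u v Z X : ℕ} {i j : Fin p} →
      u + 1 * toℕ i + Z ≋ v + 0 + X → u + 1 * toℕ j + Z ≋ v + 0 + X → i ≡ j
    solve {u} {v} {Z} {X} {i} {j} ei ej = toℕ-≋-injective (≋-trans (≡⇒≋ (sym (*-identityˡ (toℕ i))))
      (≋-trans (+-cancelˡ u (+-cancelʳ Z (≋-trans ei (≋-sym ej)))) (≡⇒≋ (*-identityˡ (toℕ j)))))
    unique : ∀ b c → b ≢ c → ∀ A {i j : Fin p} →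
      u + bit b * toℕ i + ∑ℕ z A ≋ v + bit c * toℕ i + ∑ℕ x A →
      u + bit b * toℕ j + ∑ℕ z A ≋ v + bit c * toℕ j + ∑ℕ x A → i ≡ j
    unique false false b≢c A ei ej = contradiction refl b≢c
    unique true  true  b≢c A ei ej = contradiction refl b≢c
    unique true  false b≢c A ei ej = solve {u} {v} ei ej
    unique false true  b≢c A ei ej = solve {v} {u} (≋-sym ei) (≋-sym ej)

  collides : ∀ {r} → Vec (Fin p) r → Vec Bool r → Vec Bool r → ℚ
  collides A x z = indicator (not (does (z ≟ᵇ x)) ∧ does (∑[ z ] A ≟ᶠ ∑[ x ] A))

  -- The number of vectors other than `x` with the same sum, written as `2 ^ r` times a probability
  -- so that it can be exchanged with the other averages.
  collisions : ∀ {r} → Vec (Fin p) r → Vec Bool r → ℚ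
  collisions {r} A x = fromNat (2 ^ r) ℚ.* E (iid coin r) (collides A x)

  E-collisions-≤ : ∀ {p-1} → p ≡ suc p-1 → ∀ r →
    E (iid (uniform p) r) (λ A → E (iid coin r) (collisions A)) ℚ.≤ fromNat (2 ^ r) ℚ.* frac 1 p-1
  E-collisions-≤ {p-1} p≡ r = begin
    E 𝔸 (λ A → E 𝔹 (λ x → N ℚ.* E 𝔹 (collides A x)))
      ≡⟨ trans (E-cong 𝔸 λ A → E-* 𝔹 N _) (E-* 𝔸 N _) ⟩
    N ℚ.* E 𝔸 (λ A → E 𝔹 (λ x → E 𝔹 (collides A x)))
      ≤⟨ ℚₚ.*-monoˡ-≤-nonNeg N {{frac-nonNeg (2 ^ r) 0}} each ⟩
    N ℚ.* frac 1 p-1 ∎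
    where
    open ℚₚ.≤-Reasoning
    N = fromNat (2 ^ r)
    𝔸 = iid (uniform p) r
    𝔹 = iid coin r
    0≤1/p : 0ℚ ℚ.≤ frac 1 p-1
    0≤1/p = ℚₚ.nonNegative⁻¹ (frac 1 p-1) {{frac-nonNeg 1 p-1}}
    pair : ∀ x z → E 𝔸 (λ A → collides A x z) ℚ.≤ frac 1 p-1
    pair x z with z ≟ᵇ x
    ... | yes _  = ℚₚ.≤-trans (E-const-≤ 𝔸 ℚₚ.≤-refl) 0≤1/p
    ... | no z≢x = collision-≤ p≡ z x z≢x 0 0
    each : E 𝔸 (λ A → E 𝔹 (λ x → E 𝔹 (collides A x))) ℚ.≤ frac 1 p-1
    each = begin
      E 𝔸 (λ A → E 𝔹 (λ x → E 𝔹 (collides A x)))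
        ≡⟨ trans (E-comm 𝔸 𝔹 _) (E-cong 𝔹 λ x → E-comm 𝔸 𝔹 _) ⟩
      E 𝔹 (λ x → E 𝔹 (λ z → E 𝔸 (λ A → collides A x z)))
        ≤⟨ E-mono 𝔹 (λ x → E-mono 𝔹 (pair x)) ⟩
      E 𝔹 (λ x → E 𝔹 (λ z → frac 1 p-1))
        ≤⟨ ℚₚ.≤-trans (E-mono 𝔹 (λ x → E-const-≤ 𝔹 0≤1/p)) (E-const-≤ 𝔹 0≤1/p) ⟩
      frac 1 p-1 ∎

  indicator-nonNeg : ∀ b → 0ℚ ℚ.≤ indicator b
  indicator-nonNeg false = ℚₚ.≤-refl
  indicator-nonNeg true  = 0≤1

  -- A valid `z` either is `x` or is itself one of the collisions of `x`. The error term does not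
  -- mention `z`, hence it is independent of how the algorithm chose its answer.
  solution-≤ : ∀ {r} h (A : Vec (Fin p) r) x z →
    indicator (h ∧ does (∑[ z ] A ≟ᶠ ∑[ x ] A)) ℚ.≤ indicator (h ∧ does (z ≟ᵇ x)) ℚ.+ collisions A x
  solution-≤ {r} h A x z = ℚₚ.≤-trans (cases h)
    (ℚₚ.+-monoʳ-≤ (indicator (h ∧ does (z ≟ᵇ x))) (≤-2^r*E-coins z (collides A x) (λ z → indicator-nonNeg _)))
    where
    cases : ∀ h → indicator (h ∧ does (∑[ z ] A ≟ᶠ ∑[ x ] A)) ℚ.≤ indicator (h ∧ does (z ≟ᵇ x)) ℚ.+ collides A x z
    cases false = ℚₚ.≤-trans (indicator-nonNeg _) (ℚₚ.≤-reflexive (sym (ℚₚ.+-identityˡ (collides A x z))))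
    cases true with z ≟ᵇ x
    ... | yes refl = ℚₚ.≤-trans (ℚₚ.≤-reflexive (cong indicator (dec-true (∑[ z ] A ≟ᶠ ∑[ z ] A) refl)))
      (ℚₚ.≤-reflexive (sym (ℚₚ.+-identityʳ 1ℚ)))
    ... | no _ = ℚₚ.≤-reflexive (sym (ℚₚ.+-identityˡ _))

-- Word width, and subsets of a given size

n≤2^⌈log₂n⌉ : ∀ n → n ≤ 2 ^ ⌈log₂ n ⌉
n≤2^⌈log₂n⌉ = <-rec _ λ
  { 0 _ → z≤n
  ; 1 _ → m^n>0 2 ⌈log₂ 1 ⌉
  ; n@(suc (suc m)) rec → begin
      n                               ≡⟨ ⌊n/2⌋+⌈n/2⌉≡n n ⟨
      ⌊ n /2⌋ + ⌈ n /2⌉               ≤⟨ +-monoˡ-≤ ⌈ n /2⌉ (⌊n/2⌋≤⌈n/2⌉ n) ⟩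
      ⌈ n /2⌉ + ⌈ n /2⌉               ≡⟨ cong (⌈ n /2⌉ +_) (+-identityʳ ⌈ n /2⌉) ⟨
      2 * ⌈ n /2⌉                     ≤⟨ *-monoʳ-≤ 2 (rec (⌈n/2⌉<n m)) ⟩
      2 ^ suc ⌈log₂ ⌈ n /2⌉ ⌉         ≡⟨ cong (λ l → 2 ^ suc l) (⌈log₂⌈n/2⌉⌉≡⌈log₂n⌉∸1 n) ⟩
      2 ^ suc (⌈log₂ n ⌉ ∸ 1)         ≡⟨ cong (2 ^_) (m+[n∸m]≡n (⌈log₂⌉-mono-≤ (s≤s (s≤s (z≤n {m}))))) ⟩
      2 ^ ⌈log₂ n ⌉                   ∎ }
  where open ≤-Reasoning

square-fits : ∀ r N → (r + N) * (r + N) ≤ 2 ^ wordSize r N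
square-fits r N = begin
  (r + N) * (r + N)     ≤⟨ *-mono-≤ (n≤2^⌈log₂n⌉ (r + N)) (n≤2^⌈log₂n⌉ (r + N)) ⟩
  2 ^ L * 2 ^ L         ≡⟨ ^-distribˡ-+-* 2 L L ⟨
  2 ^ (L + L)           ≡⟨ cong (λ l → 2 ^ (L + l)) (+-identityʳ L) ⟨
  2 ^ wordSize r N      ∎
  where
  open ≤-Reasoning
  L = ⌈log₂ (r + N) ⌉

∈-allSubsets : ∀ {r} (S : Subset r) → S ∈ allSubsets r
∈-allSubsets []            = here refl
∈-allSubsets (outside ∷ S) = ∈-++⁺ˡ (∈-map⁺ (outside ∷_) (∈-allSubsets S))
∈-allSubsets (inside  ∷ S) = ∈-++⁺ʳ _ (∈-map⁺ (inside ∷_) (∈-allSubsets S))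

subsetOfSize : ∀ {k r} → k ≤ r → ∃ λ (S : Subset r) → ∣ S ∣ ≡ k
subsetOfSize {r = zero}  z≤n       = [] , refl
subsetOfSize {r = suc r} z≤n       with S , size ← subsetOfSize {r = r} z≤n = outside ∷ S , size
subsetOfSize             (s≤s k≤r) with S , size ← subsetOfSize k≤r = inside ∷ S , cong suc size

subsetsOfSize-nonempty : ∀ {k r} → k ≤ r → NonZero (length (subsetsOfSize k r))
subsetsOfSize-nonempty {k} {r} k≤r with S , size ← subsetOfSize k≤r =
  nonempty (∈-filter⁺ (λ S → ∣ S ∣ ≟ k) (∈-allSubsets S) size)
  where
  nonempty : ∀ {S : Subset r} {Ss} → S ∈ Ss → NonZero (length Ss)
  nonempty (here _)  = _
  nonempty (there _) = _

E-bind₃ : ∀ {A B C D : Set} (m₁ : Rand A) (m₂ : Rand B) (m₃ : A → B → Rand C) (h : A → B → C → D) f →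
  E (m₁ >>= λ a → m₂ >>= λ b → m₃ a b >>= λ c → return (h a b c)) f ≡
  E m₁ (λ a → E m₂ (λ b → E (m₃ a b) (λ c → f (h a b c))))
E-bind₃ m₁ m₂ m₃ h f = trans (E-bind m₁ _ f) (E-cong m₁ λ a →
  trans (E-bind m₂ _ f) (E-cong m₂ λ b → E-bind (m₃ a b) _ f))

-- Uniformity of the masked instance

module Rerandomisation {p : ℕ} .{{_ : NonZero p}} (pr : Prime p) {k r : ℕ} (1≤k : 1 ≤ k) (k<p : k < p) where
  open Modular {p}

  private
    𝔸 = iid (uniform p) r
    𝔹 = iid coin r

  -- For fixed `s` the translation preserves the law of the whole vector, after which `s` survives
  -- only in coordinate `i`. There it enters through an injective affine map, so the coordinate is
  -- simply resampled.
  translate-plant-uniform : (S : Subset r) → ∣ S ∣ ≡ k → ∀ H →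
    E 𝔸 (λ X → E (uniform p) (λ s → H (Vec.map (translate s) (plant S X)))) ≡ E 𝔸 H
  translate-plant-uniform S size H with i , min≡ , i∈S ← min-inside S (trans size (sym (m+[n∸m]≡n 1≤k))) = begin
    E 𝔸 (λ X → E U (λ s → H (Vec.map (translate s) (plant S X))))
      ≡⟨ E-cong 𝔸 (λ X → E-cong U λ s → cong H (translate-plant S X s min≡ i∈S size)) ⟩
    E 𝔸 (λ X → E U (λ s → G s (Vec.map (translate s) X)))
      ≡⟨ E-comm 𝔸 U (λ X s → G s (Vec.map (translate s) X)) ⟩
    E U (λ s → E 𝔸 (λ X → G s (Vec.map (translate s) X)))
      ≡⟨ E-cong U (λ s → trans
           (E-cong 𝔸 (λ X → cong (G s) (sym (zipWith-replicate₁ translate s X))))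
           (E-iid-zipWith U translate (λ s → uniform-injective (translate-injective s)) (Vec.replicate r s) (G s))) ⟩
    E U (λ s → E 𝔸 (G s))
      ≡⟨ E-comm U 𝔸 G ⟩
    E 𝔸 (λ Y → E U (λ s → G s Y))
      ≡⟨ E-cong 𝔸 (λ Y → uniform-injective
           (affine-injective pr 1≤k k<p (neg (∑[ S - i ] Y))) (λ a → H (Y Vec.[ i ]≔ a))) ⟩
    E 𝔸 (λ Y → E U (λ a → H (Y Vec.[ i ]≔ a)))
      ≡⟨ E-iid-update U (avg-const p) i H ⟩
    E 𝔸 H ∎
    where
    open ≡-Reasoning
    U = uniform p
    G : Fin p → Vec (Fin p) r → ℚ
    G s Y = H (Y Vec.[ i ]≔ affine k (neg (∑[ S - i ] Y)) s)

  -- The order of the exchanges matters. With `ys` fixed, the sign changes are a fixed bijection and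
  -- can be removed from the uniform `A`; only then does `ys` occur in the second argument alone,
  -- where the exclusive or with `S` is again a bijection.
  rerandomise : (S : Subset r) → ∣ S ∣ ≡ k → ∀ (g : Vec (Fin p) r → Vec Bool r → ℚ) →
    E 𝔸 (λ X → E (uniform p) (λ s → E 𝔹 (λ ys → g (masked s ys (plant S X)) (Vec.zipWith _xor_ ys S)))) ≡
    E 𝔸 (λ A → E 𝔹 (g A))
  rerandomise S size g = begin
    E 𝔸 (λ X → E U (λ s → E 𝔹 (λ ys → F X s ys)))
      ≡⟨ E-cong 𝔸 (λ X → E-comm U 𝔹 (F X)) ⟩
    E 𝔸 (λ X → E 𝔹 (λ ys → E U (λ s → F X s ys)))
      ≡⟨ E-comm 𝔸 𝔹 (λ X ys → E U (λ s → F X s ys)) ⟩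
    E 𝔹 (λ ys → E 𝔸 (λ X → E U (λ s → F X s ys)))
      ≡⟨ E-cong 𝔹 (λ ys → translate-plant-uniform S size
           (λ A → g (Vec.zipWith negateIf ys A) (Vec.zipWith _xor_ ys S))) ⟩
    E 𝔹 (λ ys → E 𝔸 (λ A → g (Vec.zipWith negateIf ys A) (Vec.zipWith _xor_ ys S)))
      ≡⟨ E-cong 𝔹 (λ ys → E-iid-zipWith U negateIf (λ b → uniform-injective (negateIf-injective b)) ys
           (λ A → g A (Vec.zipWith _xor_ ys S))) ⟩
    E 𝔹 (λ ys → E 𝔸 (λ A → g A (Vec.zipWith _xor_ ys S)))
      ≡⟨ E-cong 𝔹 (λ ys → E-cong 𝔸 λ A → cong (g A) (zipWith-comm xor-comm ys S)) ⟩
    E 𝔹 (λ ys → E 𝔸 (λ A → g A (Vec.zipWith _xor_ S ys)))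
      ≡⟨ E-iid-zipWith coin _xor_ E-coin-xor S (λ x → E 𝔸 (λ A → g A x)) ⟩
    E 𝔹 (λ x → E 𝔸 (λ A → g A x))
      ≡⟨ E-comm 𝔹 𝔸 (λ x A → g A x) ⟩
    E 𝔸 (λ A → E 𝔹 (g A)) ∎
    where
    open ≡-Reasoning
    U = uniform p
    F : Vec (Fin p) r → Fin p → Vec Bool r → ℚ
    F X s ys = g (masked s ys (plant S X)) (Vec.zipWith _xor_ ys S)

-- The reduction at fixed `r` and `p`

module _ (P : Program) {k r p-1 : ℕ} (pr : Prime (suc p-1)) (1≤k : 1 ≤ k) (k<p : k < suc p-1)
         (k≤r : k ≤ r) (τ e τ′ : ℕ) (budget : 4 + (r * 6 + suc (τ + suc (r * 3 + suc e))) ≡ τ′)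
         (halts : SubsetSum.HaltsInTime P r (suc p-1) τ) where

  open Modular {suc p-1}
  open Rerandomisation pr {r = r} 1≤k k<p

  private
    p = suc p-1
    module SS = SubsetSum P r p τ
    module KS = KSum k (reduction k P) r p τ′
    𝔸 = iid (uniform p) r
    𝔹 = iid coin r
    𝕊 = uniformFrom (subsetsOfSize k r)
    w = wordSize r p

    r+p≤ : r + p ≤ (r + p) * (r + p)
    r+p≤ = m≤m*n (r + p) (r + p) {{>-nonZero (<-≤-trans z<s (m≤n+m p r))}}

    fits : ∀ {n} → n < p * p → n < 2 ^ w
    fits n<p² = <-≤-trans n<p² (≤-trans (*-mono-≤ (m≤n+m p r) (m≤n+m p r)) (square-fits r p))

    fits-r : ∀ {n} → n ≤ r → n < 2 ^ w
    fits-r n≤r = ≤-trans (≤-<-trans n≤r (m<m+n r z<s)) (≤-trans r+p≤ (square-fits r p))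

    Recovery : Config → Vec Bool r × Config → Set
    Recovery = Recovers w r k p-1 (≤-trans (s≤s 1≤k) k<p) k<p fits fits-r

    simulated : Vec (Fin p) r → Rand (Vec Bool r × Config)
    simulated X = uniform p >>= λ s → 𝔹 >>= λ ys →
      SS.execute (masked s ys X) (maskedTarget k s ys X) >>= λ c → return (ys , c)

    simulation : ∀ X → Lift Recovery (KS.execute X) (simulated X)
    simulation X = Coupled.lift (subst
      (λ τ → Coupled w Recovery τ (start (reduction k P) (kSumInput X)) (simulated X)) budget
      (reduction-simulates w r k p-1 _ k<p fits fits-r P τ e X halts))

    -- The probability that the subset-sum algorithm finds the hidden vector itself.
    recovery : Vec (Fin p) r → Vec Bool r → ℚ
    recovery A x = E (SS.execute A (∑[ x ] A)) (λ c → indicator (halted c ∧ does (answer c ≟ᵇ x)))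

    collisions-nonNeg : ∀ A x → 0ℚ ℚ.≤ collisions {r} A x
    collisions-nonNeg A x = ℚₚ.≤-trans (ℚₚ.≤-reflexive (sym (ℚₚ.*-zeroʳ N)))
      (ℚₚ.*-monoˡ-≤-nonNeg N {{frac-nonNeg (2 ^ r) 0}} (E-nonNeg 𝔹 (λ z → indicator-nonNeg _)))
      where N = fromNat (2 ^ r)

    SS-≤-recovery : Pr SS.experiment ℚ.≤ E 𝔸 (λ A → E 𝔹 (recovery A)) ℚ.+ fromNat (2 ^ r) ℚ.* frac 1 p-1
    SS-≤-recovery = begin
      Pr SS.experiment
        ≡⟨ trans (Pr≡E SS.experiment) (E-bind₃ 𝔸 𝔹 (λ A x → SS.execute A (∑[ x ] A))
             (λ A x c → halted c ∧ does (∑[ answer c ] A ≟ᶠ ∑[ x ] A)) indicator) ⟩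
      E 𝔸 (λ A → E 𝔹 (λ x → E (SS.execute A (∑[ x ] A)) (λ c → indicator (halted c ∧ does (∑[ answer c ] A ≟ᶠ ∑[ x ] A)))))
        ≤⟨ E-mono 𝔸 (λ A → E-mono 𝔹 (λ x → each A x)) ⟩
      E 𝔸 (λ A → E 𝔹 (λ x → recovery A x ℚ.+ collisions A x))
        ≡⟨ trans (E-cong 𝔸 (λ A → E-+ 𝔹 (recovery A) (collisions A))) (E-+ 𝔸 _ _) ⟩
      E 𝔸 (λ A → E 𝔹 (recovery A)) ℚ.+ E 𝔸 (λ A → E 𝔹 (collisions A))
        ≤⟨ ℚₚ.+-monoʳ-≤ (E 𝔸 (λ A → E 𝔹 (recovery A))) (E-collisions-≤ refl r) ⟩
      E 𝔸 (λ A → E 𝔹 (recovery A)) ℚ.+ fromNat (2 ^ r) ℚ.* frac 1 p-1 ∎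
      where
      open ℚₚ.≤-Reasoning
      each : ∀ A x → E (SS.execute A (∑[ x ] A)) (λ c → indicator (halted c ∧ does (∑[ answer c ] A ≟ᶠ ∑[ x ] A)))
             ℚ.≤ recovery A x ℚ.+ collisions A x
      each A x = ℚₚ.≤-trans (E-mono m (λ c → solution-≤ (halted c) A x (answer c)))
        (ℚₚ.≤-trans (ℚₚ.≤-reflexive (E-+ m _ _))
        (ℚₚ.+-monoʳ-≤ (recovery A x) (E-const-≤ m (collisions-nonNeg A x))))
        where m = SS.execute A (∑[ x ] A)

    solved : ∀ S X → ∣ S ∣ ≡ k → ∀ c ysc′ → Recovery c ysc′ →
      indicator (halted (proj₂ ysc′) ∧ does (answer (proj₂ ysc′) ≟ᵇ Vec.zipWith _xor_ (proj₁ ysc′) S)) ℚ.≤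
      indicator (halted c ∧ KS.isSolution (plant S X) (answer c))
    solved S X size c (ys , c′) rec with answer {r} c′ ≟ᵇ Vec.zipWith _xor_ ys S
    ... | no _ = ℚₚ.≤-trans (ℚₚ.≤-reflexive (cong indicator (Bool.∧-zeroʳ (halted c′)))) (indicator-nonNeg _)
    ... | yes ans with i , min≡ , i∈S ← min-inside S (trans size (sym (m+[n∸m]≡n 1≤k))) =
      ℚₚ.≤-trans (indicator≤1 _) (ℚₚ.≤-reflexive (sym (cong indicator solution)))
      where
      indicator≤1 : ∀ b → indicator b ℚ.≤ 1ℚ
      indicator≤1 false = 0≤1
      indicator≤1 true  = ℚₚ.≤-refl
      halted-true : ∀ c → Halted c → halted c ≡ true
      halted-true ([] , σ) refl = refl
      solution : halted c ∧ KS.isSolution (plant S X) (answer c) ≡ true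
      solution = cong₂ _∧_ (halted-true c (Recovers.halts rec)) (trans
        (cong (KS.isSolution (plant S X)) (trans (Recovers.answer≡ rec)
          (trans (cong (Vec.zipWith _xor_ ys) ans) (xor-cancelˡ ys S))))
        (cong₂ _∧_ (dec-true (∣ S ∣ ≟ k) size)
          (dec-true (∑[ S ] (plant S X) ≟ᶠ zeroₙ) (mod-cong (plant-solves S X min≡ i∈S)))))

    -- Rerandomisation yields the same value `Q` for each `S`. The choice of `S` is therefore moved
    -- outermost, where averaging the constant `Q` returns `Q`, since `k ≤ r` makes the list of
    -- subsets nonempty.
    recovery-≤-KS : E 𝔸 (λ A → E 𝔹 (recovery A)) ℚ.≤ Pr KS.experiment
    recovery-≤-KS = begin
      Q                                                 ≡⟨ avg-const _ {{subsetsOfSize-nonempty k≤r}} Q ⟨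
      E 𝕊 (λ _ → Q)
        ≤⟨ E-uniformFrom-mono (all-filter (λ S → ∣ S ∣ ≟ k) (allSubsets r)) each ⟩
      E 𝕊 (λ S → E 𝔸 (λ X → F X S))                     ≡⟨ E-comm 𝕊 𝔸 (λ S X → F X S) ⟩
      E 𝔸 (λ X → E 𝕊 (F X))
        ≡⟨ trans (Pr≡E KS.experiment) (E-bind₃ 𝔸 𝕊 (λ X S → KS.execute (plant S X))
             (λ X S c → halted c ∧ KS.isSolution (plant S X) (answer c)) indicator) ⟨
      Pr KS.experiment                                  ∎
      where
      open ℚₚ.≤-Reasoning
      Q = E 𝔸 (λ A → E 𝔹 (recovery A))
      F : Vec (Fin p) r → Subset r → ℚ
      F X S = E (KS.execute (plant S X)) (λ c → indicator (halted c ∧ KS.isSolution (plant S X) (answer c)))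
      each : ∀ S → ∣ S ∣ ≡ k → Q ℚ.≤ E 𝔸 (λ X → F X S)
      each S size = let i , min≡ , i∈S = min-inside S (trans size (sym (m+[n∸m]≡n 1≤k))) in begin
        Q
          ≡⟨ rerandomise S size recovery ⟨
        E 𝔸 (λ X → E (uniform p) (λ s → E 𝔹 (λ ys → recovery (masked s ys (plant S X)) (Vec.zipWith _xor_ ys S))))
          ≤⟨ E-mono 𝔸 (λ X → ℚₚ.≤-trans (ℚₚ.≤-reflexive (unfold (plant-solves S X min≡ i∈S)))
               (Lift-E (simulation (plant S X)) (solved S X size))) ⟩
        E 𝔸 (λ X → F X S) ∎
        where
        found : Vec Bool r × Config → ℚ
        found ysc = indicator (halted (proj₂ ysc) ∧ does (answer (proj₂ ysc) ≟ᵇ Vec.zipWith _xor_ (proj₁ ysc) S))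
        unfold : ∀ {X} → ∑ℕ S (plant S X) ≋ 0 →
          E (uniform p) (λ s → E 𝔹 (λ ys → recovery (masked s ys (plant S X)) (Vec.zipWith _xor_ ys S))) ≡
          E (simulated (plant S X)) found
        unfold {X} ΣX≋0 = sym (trans
          (E-bind₃ (uniform p) 𝔹 (λ s ys → SS.execute (masked s ys (plant S X)) (maskedTarget k s ys (plant S X)))
            (λ s ys c → (ys , c)) found)
          (E-cong (uniform p) λ s → E-cong 𝔹 λ ys →
            cong (λ t → E (SS.execute (masked s ys (plant S X)) t) (λ c → found (ys , c)))
              (maskedTarget-correct S (plant S X) s ys size ΣX≋0)))

  reduction-halts : KS.HaltsInTime
  reduction-halts X = Lift-Always (simulation X) (λ _ _ → Recovers.halts)

  reduction-succeeds : Pr SS.experiment ℚ.≤ Pr KS.experiment ℚ.+ fromNat (2 ^ r) ℚ.* frac 1 p-1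
  reduction-succeeds = ℚₚ.≤-trans SS-≤-recovery (ℚₚ.+-monoˡ-≤ _ recovery-≤-KS)

-- Densities as cuts

0<-* : ∀ {a b} → 0ℚ ℚ.< a → 0ℚ ℚ.< b → 0ℚ ℚ.< a ℚ.* b
0<-* {a} {b} 0<a 0<b = ℚₚ.positive⁻¹ (a ℚ.* b) {{ℚₚ.pos*pos⇒pos a {{ℚ.positive 0<a}} b {{ℚ.positive 0<b}}}}

ℚ*-monoˡ-≤ : ∀ {a b c} → 0ℚ ℚ.< a → b ℚ.≤ c → a ℚ.* b ℚ.≤ a ℚ.* c
ℚ*-monoˡ-≤ {a} 0<a = ℚₚ.*-monoˡ-≤-nonNeg a {{ℚ.nonNegative (ℚₚ.<⇒≤ 0<a)}}

ℚ*-monoʳ-≤ : ∀ {a b c} → 0ℚ ℚ.< a → b ℚ.≤ c → b ℚ.* a ℚ.≤ c ℚ.* a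
ℚ*-monoʳ-≤ {a} 0<a = ℚₚ.*-monoʳ-≤-nonNeg a {{ℚ.nonNegative (ℚₚ.<⇒≤ 0<a)}}

ℚ*-cancelˡ-≤ : ∀ {a b c} → 0ℚ ℚ.< a → a ℚ.* b ℚ.≤ a ℚ.* c → b ℚ.≤ c
ℚ*-cancelˡ-≤ {a} 0<a = ℚₚ.*-cancelˡ-≤-pos a {{ℚ.positive 0<a}}

reciprocal : ∀ {a} → 0ℚ ℚ.< a → ∃ λ b → 0ℚ ℚ.< b × b ℚ.* a ≡ 1ℚ
reciprocal {a} 0<a = (ℚ.1/ a) , ℚₚ.positive⁻¹ (ℚ.1/ a) {{ℚₚ.1/pos⇒pos a}} , ℚₚ.*-inverseˡ a
  where
  instance
    a-positive = ℚ.positive 0<a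
    a-nonZero  = ℚₚ.pos⇒nonZero a

-- The order property behind all cancellations below. Even `log₂ 0` has it, its lower part being
-- empty, so no case distinction on the argument of the logarithm arises.
Ordered : Cut → Set
Ordered x = ∀ {q s} → lower x q → upper x s → q ℚ.< s

fromℚ-ordered : ∀ q → Ordered (fromℚ q)
fromℚ-ordered q = ℚₚ.<-trans

-- Both power inequalities are raised until they share the middle term `n ^ (suc b * suc b′)`; what
-- remains compares two powers of 2.
log₂-ordered : ∀ n → Ordered (log₂ n)
log₂-ordered n {q} {s} (a , b , q≤ , 2^a<) (a′ , b′ , ≤s , <2^a′) =
  ℚₚ.≤-<-trans q≤ (ℚₚ.<-≤-trans (frac-< {a} {b} {a′} {b′} (≰⇒> λ le →
    <⇒≱ powers (^-monoʳ-≤ 2 le))) ≤s)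
  where
  powers : 2 ^ (a * suc b′) < 2 ^ (a′ * suc b)
  powers = begin-strict
    2 ^ (a * suc b′)             ≡⟨ ^-*-assoc 2 a (suc b′) ⟨
    (2 ^ a) ^ suc b′             <⟨ ^-monoˡ-< (suc b′) 2^a< ⟩
    (n ^ suc b) ^ suc b′         ≡⟨ ^-*-assoc n (suc b) (suc b′) ⟩
    n ^ (suc b * suc b′)         ≡⟨ cong (n ^_) (*-comm (suc b) (suc b′)) ⟩
    n ^ (suc b′ * suc b)         ≡⟨ ^-*-assoc n (suc b′) (suc b) ⟨
    (n ^ suc b′) ^ suc b         <⟨ ^-monoˡ-< (suc b) <2^a′ ⟩
    (2 ^ a′) ^ suc b             ≡⟨ ^-*-assoc 2 a′ (suc b) ⟩
    2 ^ (a′ * suc b)             ∎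
    where open ≤-Reasoning

IsReal⇒ordered : ∀ {x} → IsReal x → Ordered x
IsReal⇒ordered {x} real {q} {s} x>q x<s = ℚₚ.≰⇒> λ s≤q → disjoint s (lower-≤ s≤q , x<s)
  where
  open IsReal real
  lower-≤ : s ℚ.≤ q → lower x s
  lower-≤ s≤q with t , q<t , x>t ← Equivalence.to (lower-rounded q) x>q =
    Equivalence.from (lower-rounded s) (t , ℚₚ.≤-<-trans s≤q q<t , x>t)

-- Cancelling the common factors k and log r of the two densities.
module _ {K L P R Δ e : Cut} (K-ordered : Ordered K) (L-ordered : Ordered L) where

  cancel-upper : K ·ʳ L ÷ʳ P <ʳ e ·ʳ (K ·ʳ Δ ·ʳ L ÷ʳ R) → R ÷ʳ P <ʳ e ·ʳ Δ
  cancel-upper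
    (q , (s , t , 0<s , 0<t , (k⁺ , ℓ⁺ , 0<k⁺ , 0<ℓ⁺ , K<k⁺ , L<ℓ⁺ , kℓ≤s) , t<P , s≤qt)
       , (e⁻ , z , 0<e , 0<z , e⁻<e
         , (m , ρ , 0<m , 0<ρ
           , (n , ℓ⁻ , 0<n , 0<ℓ⁻ , (k⁻ , δ , 0<k⁻ , 0<δ , k⁻<K , δ<Δ , n≤kδ) , ℓ⁻<L , m≤nℓ)
           , R<ρ , zρ≤m)
         , q≤ez)) =
    -- The separating rational is the lower estimate of the right-hand side. The factor `k⁺ ℓ⁺`
    -- cancels after the lower estimates `k⁻` and `ℓ⁻` have been enlarged to `k⁺` and `ℓ⁺`.
    e⁻ ℚ.* δ
    , (ρ , t , 0<ρ , 0<t , R<ρ , t<P , ℚ*-cancelˡ-≤ (0<-* 0<k⁺ 0<ℓ⁺) chain)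
    , (e⁻ , δ , 0<e , 0<δ , e⁻<e , δ<Δ , ℚₚ.≤-refl)
    where
    open ℚₚ.≤-Reasoning
    0<et = 0<-* 0<e 0<t
    chain : k⁺ ℚ.* ℓ⁺ ℚ.* ρ ℚ.≤ k⁺ ℚ.* ℓ⁺ ℚ.* (e⁻ ℚ.* δ ℚ.* t)
    chain = begin
      k⁺ ℚ.* ℓ⁺ ℚ.* ρ                    ≤⟨ ℚ*-monoʳ-≤ 0<ρ kℓ≤s ⟩
      s ℚ.* ρ                            ≤⟨ ℚ*-monoʳ-≤ 0<ρ s≤qt ⟩
      q ℚ.* t ℚ.* ρ                      ≤⟨ ℚ*-monoʳ-≤ 0<ρ (ℚ*-monoʳ-≤ 0<t q≤ez) ⟩
      e⁻ ℚ.* z ℚ.* t ℚ.* ρ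
        ≡⟨ solve 4 (λ e z t ρ → ((e ⊕ z) ⊕ t) ⊕ ρ ⊜ (e ⊕ t) ⊕ (z ⊕ ρ)) refl e⁻ z t ρ ⟩
      e⁻ ℚ.* t ℚ.* (z ℚ.* ρ)             ≤⟨ ℚ*-monoˡ-≤ 0<et zρ≤m ⟩
      e⁻ ℚ.* t ℚ.* m                     ≤⟨ ℚ*-monoˡ-≤ 0<et m≤nℓ ⟩
      e⁻ ℚ.* t ℚ.* (n ℚ.* ℓ⁻)            ≤⟨ ℚ*-monoˡ-≤ 0<et (ℚ*-monoʳ-≤ 0<ℓ⁻ n≤kδ) ⟩
      e⁻ ℚ.* t ℚ.* (k⁻ ℚ.* δ ℚ.* ℓ⁻)
        ≤⟨ ℚ*-monoˡ-≤ 0<et (ℚ*-monoʳ-≤ 0<ℓ⁻ (ℚ*-monoʳ-≤ 0<δ (ℚₚ.<⇒≤ (K-ordered k⁻<K K<k⁺)))) ⟩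
      e⁻ ℚ.* t ℚ.* (k⁺ ℚ.* δ ℚ.* ℓ⁻)
        ≤⟨ ℚ*-monoˡ-≤ 0<et (ℚ*-monoˡ-≤ (0<-* 0<k⁺ 0<δ) (ℚₚ.<⇒≤ (L-ordered ℓ⁻<L L<ℓ⁺))) ⟩
      e⁻ ℚ.* t ℚ.* (k⁺ ℚ.* δ ℚ.* ℓ⁺)
        ≡⟨ solve 5 (λ e t k d l → (e ⊕ t) ⊕ ((k ⊕ d) ⊕ l) ⊜ (k ⊕ l) ⊕ ((e ⊕ d) ⊕ t)) refl e⁻ t k⁺ δ ℓ⁺ ⟩
      k⁺ ℚ.* ℓ⁺ ℚ.* (e⁻ ℚ.* δ ℚ.* t)     ∎
      where open ℚ*

  cancel-lower : K ·ʳ Δ ·ʳ L ÷ʳ R <ʳ e ·ʳ (K ·ʳ L ÷ʳ P) → Δ <ʳ e ·ʳ (R ÷ʳ P)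
  cancel-lower
    (q , (m , ρ , 0<m , 0<ρ
         , (n , ℓ⁺ , 0<n , 0<ℓ⁺ , (k⁺ , δ , 0<k⁺ , 0<δ , K<k⁺ , Δ<δ , kδ≤n) , L<ℓ⁺ , nℓ≤m)
         , ρ<R , m≤qρ)
       , (e⁻ , z , 0<e , 0<z , e⁻<e
         , (s , t , 0<s , 0<t , (k⁻ , ℓ⁻ , 0<k⁻ , 0<ℓ⁻ , k⁻<K , ℓ⁻<L , s≤kℓ) , P<t , zt≤s)
         , q≤ez))
    -- A rational below the quotient of `R` by `P` has to be exhibited; it is `ρ` divided by `t`,
    -- hence the reciprocal.
    with t⁻¹ , 0<t⁻¹ , t⁻¹t≡1 ← reciprocal 0<t =
    δ , Δ<δ
    , (e⁻ , ρ ℚ.* t⁻¹ , 0<e , 0<-* 0<ρ 0<t⁻¹ , e⁻<e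
      , (ρ , t , 0<ρ , 0<t , ρ<R , P<t , ℚₚ.≤-reflexive
          (trans (ℚₚ.*-assoc ρ t⁻¹ t) (trans (cong (ρ ℚ.*_) t⁻¹t≡1) (ℚₚ.*-identityʳ ρ))))
      , δ≤)
    where
    open ℚₚ.≤-Reasoning
    open ℚ*
    0<eρ = 0<-* 0<e 0<ρ
    chain : k⁺ ℚ.* ℓ⁺ ℚ.* (δ ℚ.* t) ℚ.≤ k⁺ ℚ.* ℓ⁺ ℚ.* (e⁻ ℚ.* ρ)
    chain = begin
      k⁺ ℚ.* ℓ⁺ ℚ.* (δ ℚ.* t)
        ≡⟨ solve 4 (λ k l d t → (k ⊕ l) ⊕ (d ⊕ t) ⊜ ((k ⊕ d) ⊕ l) ⊕ t) refl k⁺ ℓ⁺ δ t ⟩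
      k⁺ ℚ.* δ ℚ.* ℓ⁺ ℚ.* t              ≤⟨ ℚ*-monoʳ-≤ 0<t (ℚ*-monoʳ-≤ 0<ℓ⁺ kδ≤n) ⟩
      n ℚ.* ℓ⁺ ℚ.* t                     ≤⟨ ℚ*-monoʳ-≤ 0<t nℓ≤m ⟩
      m ℚ.* t                            ≤⟨ ℚ*-monoʳ-≤ 0<t m≤qρ ⟩
      q ℚ.* ρ ℚ.* t                      ≤⟨ ℚ*-monoʳ-≤ 0<t (ℚ*-monoʳ-≤ 0<ρ q≤ez) ⟩
      e⁻ ℚ.* z ℚ.* ρ ℚ.* t
        ≡⟨ solve 4 (λ e z ρ t → ((e ⊕ z) ⊕ ρ) ⊕ t ⊜ (e ⊕ ρ) ⊕ (z ⊕ t)) refl e⁻ z ρ t ⟩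
      e⁻ ℚ.* ρ ℚ.* (z ℚ.* t)             ≤⟨ ℚ*-monoˡ-≤ 0<eρ zt≤s ⟩
      e⁻ ℚ.* ρ ℚ.* s                     ≤⟨ ℚ*-monoˡ-≤ 0<eρ s≤kℓ ⟩
      e⁻ ℚ.* ρ ℚ.* (k⁻ ℚ.* ℓ⁻)
        ≤⟨ ℚ*-monoˡ-≤ 0<eρ (ℚ*-monoʳ-≤ 0<ℓ⁻ (ℚₚ.<⇒≤ (K-ordered k⁻<K K<k⁺))) ⟩
      e⁻ ℚ.* ρ ℚ.* (k⁺ ℚ.* ℓ⁻)
        ≤⟨ ℚ*-monoˡ-≤ 0<eρ (ℚ*-monoˡ-≤ 0<k⁺ (ℚₚ.<⇒≤ (L-ordered ℓ⁻<L L<ℓ⁺))) ⟩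
      e⁻ ℚ.* ρ ℚ.* (k⁺ ℚ.* ℓ⁺)           ≡⟨ ℚₚ.*-comm (e⁻ ℚ.* ρ) (k⁺ ℚ.* ℓ⁺) ⟩
      k⁺ ℚ.* ℓ⁺ ℚ.* (e⁻ ℚ.* ρ)           ∎
    δ≤ : δ ℚ.≤ e⁻ ℚ.* (ρ ℚ.* t⁻¹)
    δ≤ = begin
      δ                                  ≡⟨ trans (cong (δ ℚ.*_) t⁻¹t≡1) (ℚₚ.*-identityʳ δ) ⟨
      δ ℚ.* (t⁻¹ ℚ.* t)                  ≡⟨ solve 3 (λ d u t → d ⊕ (u ⊕ t) ⊜ u ⊕ (d ⊕ t)) refl δ t⁻¹ t ⟩
      t⁻¹ ℚ.* (δ ℚ.* t)                  ≤⟨ ℚ*-monoˡ-≤ 0<t⁻¹ (ℚ*-cancelˡ-≤ (0<-* 0<k⁺ 0<ℓ⁺) chain) ⟩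
      t⁻¹ ℚ.* (e⁻ ℚ.* ρ)                 ≡⟨ solve 3 (λ u e ρ → u ⊕ (e ⊕ ρ) ⊜ e ⊕ (ρ ⊕ u)) refl t⁻¹ e⁻ ρ ⟩
      e⁻ ℚ.* (ρ ℚ.* t⁻¹)                 ∎

kSumDensity⇒subsetSumDensity : ∀ {Δ k} {p : ℕ → ℕ} →
  (λ r → fromℕ k ·ʳ log₂ r ÷ʳ log₂ (p r)) ∼ (λ r → fromℕ k ·ʳ Δ ·ʳ log₂ r ÷ʳ fromℕ r) →
  (λ r → fromℕ r ÷ʳ log₂ (p r)) ∼ (λ _ → Δ)
kSumDensity⇒subsetSumDensity {Δ} {k} {p} dens ε 0<ε =
  let r₀ , close = dens ε 0<ε in
  r₀ , λ r r₀≤r → let below , above = close r r₀≤r in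
    cancel-upper {fromℕ k} {log₂ r} {log₂ (p r)} {fromℕ r} {Δ} {fromℚ (1ℚ ℚ.+ ε)}
      (fromℚ-ordered _) (log₂-ordered r) below ,
    cancel-lower {fromℕ k} {log₂ r} {log₂ (p r)} {fromℕ r} {Δ} {fromℚ (1ℚ ℚ.+ ε)}
      (fromℚ-ordered _) (log₂-ordered r) above

-- From density below 1 to a gap between `2 ^ r` and `p`

nonNeg-frac : ∀ {q} → 0ℚ ℚ.≤ q → ∃₂ λ n d → q ≡ frac n d
nonNeg-frac {q@(mkℚ (ℤ.+ n) d _)}  0≤q = n , d , sym (ℚₚ.↥p/↧p≡p q)
nonNeg-frac {q@(mkℚ -[1+ n ] d _)} 0≤q = contradiction (ℚₚ.<-≤-trans (ℚₚ.negative⁻¹ q) 0≤q) (ℚₚ.<-irrefl refl)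

0<1-q : ∀ {q} → q ℚ.< 1ℚ → 0ℚ ℚ.< 1ℚ ℚ.- q
0<1-q {q} q<1 = subst (ℚ._< 1ℚ ℚ.- q) (ℚₚ.+-inverseʳ q) (ℚₚ.+-monoˡ-< (ℚ.- q) q<1)

-- For ε = 1 − q, the product (1 + ε) q = 1 − ε² is still below 1.
margin : ∀ {q} → 0ℚ ℚ.< q → q ℚ.< 1ℚ → ∃₂ λ u v →
         u < suc v × (1ℚ ℚ.+ (1ℚ ℚ.- q)) ℚ.* q ≡ frac u v
margin {q} 0<q q<1 =
  let u , v , ρ≡ = nonNeg-frac (ℚₚ.<⇒≤ (0<-* 0<1+ε 0<q)) in
  u , v , subst₂ _<_ (*-identityʳ u) (*-identityˡ (suc v))
            (frac-<⁻¹ {u} {v} {1} {0} (subst (ℚ._< 1ℚ) ρ≡ ρ<1)) , ρ≡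
  where
  open ℚₚ.≤-Reasoning
  ε = 1ℚ ℚ.- q
  0<ε = 0<1-q q<1
  0<1+ε : 0ℚ ℚ.< 1ℚ ℚ.+ ε
  0<1+ε = ℚₚ.+-mono-< (ℚₚ.positive⁻¹ 1ℚ) 0<ε
  q+ε≡1 : q ℚ.+ ε ≡ 1ℚ
  q+ε≡1 = trans (ℚₚ.+-comm q ε) (trans (ℚₚ.+-assoc 1ℚ (ℚ.- q) q)
    (trans (cong (1ℚ ℚ.+_) (ℚₚ.+-inverseˡ q)) (ℚₚ.+-identityʳ 1ℚ)))
  ρ<1 : (1ℚ ℚ.+ ε) ℚ.* q ℚ.< 1ℚ
  ρ<1 = begin-strict
    (1ℚ ℚ.+ ε) ℚ.* q                        ≡⟨ trans (ℚₚ.*-distribʳ-+ q 1ℚ ε) (cong (ℚ._+ ε ℚ.* q) (ℚₚ.*-identityˡ q)) ⟩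
    q ℚ.+ ε ℚ.* q                           ≡⟨ ℚₚ.+-identityʳ _ ⟨
    q ℚ.+ ε ℚ.* q ℚ.+ 0ℚ                    <⟨ ℚₚ.+-monoʳ-< (q ℚ.+ ε ℚ.* q) (0<-* 0<ε 0<ε) ⟩
    q ℚ.+ ε ℚ.* q ℚ.+ ε ℚ.* ε               ≡⟨ ℚₚ.+-assoc q (ε ℚ.* q) (ε ℚ.* ε) ⟩
    q ℚ.+ (ε ℚ.* q ℚ.+ ε ℚ.* ε)             ≡⟨ cong (q ℚ.+_) (ℚₚ.*-distribˡ-+ ε q ε) ⟨
    q ℚ.+ ε ℚ.* (q ℚ.+ ε)                   ≡⟨ cong (λ x → q ℚ.+ ε ℚ.* x) q+ε≡1 ⟩
    q ℚ.+ ε ℚ.* 1ℚ                          ≡⟨ cong (q ℚ.+_) (ℚₚ.*-identityʳ ε) ⟩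
    q ℚ.+ ε                                 ≡⟨ q+ε≡1 ⟩
    1ℚ                                      ∎

-- The exponential form of r < (u / suc v) log₂ p. The lower estimate of log₂ p is certified by
-- `2 ^ a < p ^ suc b`, so the two sides are compared after raising them to the power `suc b`.
density⇒power : ∀ {Δ q ε u v} → Ordered Δ → upper Δ q →
  (1ℚ ℚ.+ ε) ℚ.* q ≡ frac u v → ∀ r p →
  fromℕ r ÷ʳ log₂ p <ʳ fromℚ (1ℚ ℚ.+ ε) ·ʳ Δ → 2 ^ (r * suc v) ≤ p ^ u
density⇒power {Δ} {q} {ε} {u} {v} ordered Δ<q ρ≡ r p
  (Q , (s , t , 0<s , 0<t , r<s , (a , b , t≤ , 2^a<) , s≤Qt) , (e , δ , 0<e , 0<δ , e<1+ε , δ<Δ , Q≤eδ)) =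
  ≮⇒≥ λ p^u<2^rv → <-irrefl refl (begin-strict
    (p ^ u) ^ suc b                 <⟨ ^-monoˡ-< (suc b) p^u<2^rv ⟩
    (2 ^ (r * suc v)) ^ suc b     ≡⟨ ^-*-assoc 2 (r * suc v) (suc b) ⟩
    2 ^ (r * suc v * suc b)       ≡⟨ cong (2 ^_) (*-assoc r (suc v) (suc b)) ⟩
    2 ^ (r * (suc v * suc b))     ≤⟨ ^-monoʳ-≤ 2 (<⇒≤ exponents) ⟩
    2 ^ (u * a)                     ≡⟨ cong (2 ^_) (*-comm u a) ⟩
    2 ^ (a * u)                     ≡⟨ ^-*-assoc 2 a u ⟨
    (2 ^ a) ^ u                     ≤⟨ ^-monoˡ-≤ u (<⇒≤ 2^a<) ⟩
    (p ^ suc b) ^ u                 ≡⟨ ^-*-assoc p (suc b) u ⟩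
    p ^ (suc b * u)                 ≡⟨ cong (p ^_) (*-comm (suc b) u) ⟩
    p ^ (u * suc b)                 ≡⟨ ^-*-assoc p u (suc b) ⟨
    (p ^ u) ^ suc b                 ∎)
  where
  bound : fromNat r ℚ.< frac (u * a) (b + v * suc b)
  bound = begin-strict
    fromNat r                           <⟨ r<s ⟩
    s                                   ≤⟨ s≤Qt ⟩
    Q ℚ.* t                             ≤⟨ ℚ*-monoʳ-≤ 0<t Q≤eδ ⟩
    e ℚ.* δ ℚ.* t                       ≤⟨ ℚ*-monoʳ-≤ 0<t (ℚ*-monoˡ-≤ 0<e (ℚₚ.<⇒≤ (ordered δ<Δ Δ<q))) ⟩
    e ℚ.* q ℚ.* t                       ≤⟨ ℚ*-monoʳ-≤ 0<t (ℚ*-monoʳ-≤ (ℚₚ.<-trans 0<δ (ordered δ<Δ Δ<q)) (ℚₚ.<⇒≤ e<1+ε)) ⟩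
    (1ℚ ℚ.+ ε) ℚ.* q ℚ.* t              ≡⟨ cong (ℚ._* t) ρ≡ ⟩
    frac u v ℚ.* t                      ≤⟨ ℚₚ.*-monoˡ-≤-nonNeg (frac u v) {{frac-nonNeg u v}} t≤ ⟩
    frac u v ℚ.* frac a b               ≡⟨ frac-* u v a b ⟩
    frac (u * a) (b + v * suc b)  ∎
    where open ℚₚ.≤-Reasoning
  exponents : r * (suc v * suc b) < u * a
  exponents = subst (r * (suc v * suc b) <_) (*-identityʳ (u * a)) (frac-<⁻¹ {r} {0} {u * a} {b + v * suc b} bound)
  open ≤-Reasoning

n<2^n : ∀ n → n < 2 ^ n
n<2^n zero    = s≤s z≤n
n<2^n (suc n) = begin-strict
  1 + n                       <⟨ +-mono-≤-< (m^n>0 2 n) (n<2^n n) ⟩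
  2 ^ n + 2 ^ n           ≡⟨ cong (2 ^ n +_) (+-identityʳ (2 ^ n)) ⟨
  2 ^ suc n                   ∎
  where open ≤-Reasoning

^-distribʳ-* : ∀ m n o → (m * n) ^ o ≡ m ^ o * n ^ o
^-distribʳ-* m n zero    = refl
^-distribʳ-* m n (suc o) = trans (cong (m * n *_) (^-distribʳ-* m n o))
  ([m*n]*[o*p]≡[m*o]*[n*p] m n (m ^ o) (n ^ o))

-- If `p` were below `M * 2 ^ r`, the hypotheses would give `2 ^ (r * suc u) ≤ M ^ u * 2 ^ (r * u)`,
-- hence `2 ^ r ≤ M ^ u ≤ r`. The spare factor `2 ^ r` comes from `u < suc v`, the trace of the
-- density being below 1.
power⇒gap : ∀ M {u v r p} → u < suc v → 2 ^ (r * suc v) ≤ p ^ u →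
            M ^ u ≤ r → M * 2 ^ r ≤ p
power⇒gap M {u} {v} {r} {p} u<v 2^rv≤p^u M^u≤r = ≮⇒≥ λ p<M2^r →
  <⇒≱ (≤-<-trans M^u≤r (n<2^n r)) (*-cancelʳ-≤ (2 ^ r) (M ^ u) (2 ^ (r * u)) (begin
    2 ^ r * 2 ^ (r * u)        ≡⟨ ^-distribˡ-+-* 2 r (r * u) ⟨
    2 ^ (r + r * u)              ≡⟨ cong (2 ^_) (*-suc r u) ⟨
    2 ^ (r * suc u)                ≤⟨ ^-monoʳ-≤ 2 (*-monoʳ-≤ r u<v) ⟩
    2 ^ (r * suc v)                ≤⟨ 2^rv≤p^u ⟩
    p ^ u                            ≤⟨ ^-monoˡ-≤ u (<⇒≤ p<M2^r) ⟩
    (M * 2 ^ r) ^ u              ≡⟨ ^-distribʳ-* M (2 ^ r) u ⟩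
    M ^ u * (2 ^ r) ^ u        ≡⟨ cong (M ^ u *_) (^-*-assoc 2 r u) ⟩
    M ^ u * 2 ^ (r * u)        ∎))
  where
  open ≤-Reasoning
  instance _ = m^n≢0 2 (r * u)

-- Masking and unmasking take 9 r + 7 steps.
budget-split : ∀ r τ τ′ → 1 ≤ r → τ + 16 * r ≤ τ′ →
  ∃ λ e → 4 + (r * 6 + suc (τ + suc (r * 3 + suc e))) ≡ τ′
budget-split r τ τ′ 1≤r enough = τ′ ∸ (9 * r + 7 + τ) ,
  trans (regroup r τ _) (m+[n∸m]≡n (begin
    -- As `1 ≤ r`, the constant 7 is at most `7 * r`; this is the origin of 16 = 9 + 7.
    9 * r + 7 + τ         ≤⟨ +-monoˡ-≤ τ (+-monoʳ-≤ (9 * r) (*-monoʳ-≤ 7 1≤r)) ⟩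
    9 * r + 7 * r + τ     ≡⟨ collect r τ ⟩
    τ + 16 * r            ≤⟨ enough ⟩
    τ′                    ∎))
  where
  open ≤-Reasoning
  regroup : ∀ r τ e → 4 + (r * 6 + suc (τ + suc (r * 3 + suc e))) ≡ 9 * r + 7 + τ + e
  regroup = solve-∀
  collect : ∀ r τ → 9 * r + 7 * r + τ ≡ τ + 16 * r
  collect = solve-∀

-- Success probability and the asymptotic statement

half : ℕ → ℚ
half d = frac 1 (d + suc d)

half+half : ∀ d → half d ℚ.+ half d ≡ frac 1 d
half+half d = begin
  half d ℚ.+ half d                    ≡⟨ cong₂ ℚ._+_ (ℚₚ.*-identityˡ (half d)) (ℚₚ.*-identityˡ (half d)) ⟨
  1ℚ ℚ.* half d ℚ.+ 1ℚ ℚ.* half d      ≡⟨ ℚₚ.*-distribʳ-+ (half d) 1ℚ 1ℚ ⟨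
  (1ℚ ℚ.+ 1ℚ) ℚ.* half d               ≡⟨ frac-* 2 0 1 (d + suc d) ⟩
  frac 2 (d + suc d + 0)               ≡⟨ frac-cong {2} {d + suc d + 0} {1} {d} (double d) ⟩
  frac 1 d                             ∎
  where
  open ≡-Reasoning
  double : ∀ d → 2 * suc d ≡ 1 * suc (d + suc d + 0)
  double = solve-∀

-- Of the success bound `frac 1 d` one half pays for the collisions, whose expected number is at
-- most 2^r / p, and the other half remains. The instance `nz` is a parameter because the moduli
-- supplied later are not successors by computation.
reduction-correct : ∀ P {k r p} (nz : NonZero p) → Prime p → 1 ≤ k → k < p → k ≤ r →
  ∀ τ τ′ {c d} → τ + 16 * r ≤ τ′ → frac 1 d ℚ.≤ c → suc (d + suc d) * 2 ^ r ≤ p →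
  SubsetSum.HaltsInTime P r p {{nz}} τ × c ℚ.≤ Pr (SubsetSum.experiment P r p {{nz}} τ) →
  KSum.HaltsInTime k (reduction k P) r p {{nz}} τ′ ×
  half d ℚ.≤ Pr (KSum.experiment k (reduction k P) r p {{nz}} τ′)
reduction-correct P {k} {r} {p = suc p-1} nz pr 1≤k k<p k≤r τ τ′ {c} {d} time 1/d≤c gap (halts , c≤)
  = let e , budget = budget-split r τ τ′ (≤-trans 1≤k k≤r) time in
  reduction-halts P pr 1≤k k<p k≤r τ e τ′ budget halts ,
  cancelʳ {half d} {Pr K.experiment} (half d) (begin
    half d ℚ.+ half d                                       ≡⟨ half+half d ⟩
    frac 1 d                                                ≤⟨ 1/d≤c ⟩
    c                                                       ≤⟨ c≤ ⟩
    Pr S.experiment                                         ≤⟨ reduction-succeeds P pr 1≤k k<p k≤r τ e τ′ budget halts ⟩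
    Pr K.experiment ℚ.+ fromNat (2 ^ r) ℚ.* frac 1 p-1      ≤⟨ ℚₚ.+-monoʳ-≤ (Pr K.experiment) few-collisions ⟩
    Pr K.experiment ℚ.+ half d                              ∎)
  where
  open ℚₚ.≤-Reasoning
  module S = SubsetSum P r (suc p-1) {{nz}} τ
  module K = KSum k (reduction k P) r (suc p-1) {{nz}} τ′
  few-collisions : fromNat (2 ^ r) ℚ.* frac 1 p-1 ℚ.≤ half d
  few-collisions = ℚₚ.≤-trans (ℚₚ.≤-reflexive (frac-* (2 ^ r) 0 1 p-1))
    (frac-≤ {2 ^ r * 1} {p-1 + 0} {1} {d + suc d} (subst₂ _≤_ (left (2 ^ r) (suc (d + suc d))) (right p-1) gap))
    where
    left : ∀ n m → m * n ≡ n * 1 * m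
    left = solve-∀
    right : ∀ n → suc n ≡ 1 * suc (n + 0)
    right = solve-∀
  cancelʳ : ∀ {a b} c → a ℚ.+ c ℚ.≤ b ℚ.+ c → a ℚ.≤ b
  cancelʳ {a} {b} c le = subst₂ ℚ._≤_ (undo a) (undo b) (ℚₚ.+-monoˡ-≤ (ℚ.- c) le)
    where
    undo : ∀ a → a ℚ.+ c ℚ.- c ≡ a
    undo a = trans (ℚₚ.+-assoc a c (ℚ.- c)) (trans (cong (a ℚ.+_) (ℚₚ.+-inverseʳ c)) (ℚₚ.+-identityʳ a))

reciprocal-≤ : ∀ {c} → 0ℚ ℚ.< c → ∃ λ d → frac 1 d ℚ.≤ c
reciprocal-≤ {c} 0<c with nonNeg-frac (ℚₚ.<⇒≤ 0<c)
... | zero  , d , c≡ = contradiction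
  (subst (0ℚ ℚ.<_) (trans c≡ (frac-cong {0} {d} {0} {0} refl)) 0<c) (ℚₚ.<-irrefl refl)
... | suc n , d , c≡ = d , subst (frac 1 d ℚ.≤_) (sym c≡)
  (frac-≤ {1} {d} {suc n} {d} (*-monoˡ-≤ (suc d) {1} {suc n} (s≤s z≤n)))

reduction-solves : ∀ {Δ} → Ordered Δ → ∀ {q u v} → upper Δ q → q ℚ.< 1ℚ →
  u < suc v → (1ℚ ℚ.+ (1ℚ ℚ.- q)) ℚ.* q ≡ frac u v →
  ∀ T ((C′ , _) : AtLeastLinear T) A ((C , c , _) : SolvesSubsetSum A Δ T) {d} → frac 1 d ℚ.≤ c →
  ∀ k → 1 ≤ k → (p : ℕ → ℕ) (prime : ∀ r → Prime (p r)) → (∀ r → k < p r) →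
  (λ r → fromℕ k ·ʳ log₂ r ÷ʳ log₂ (p r)) ∼ (λ r → fromℕ k ·ʳ Δ ·ʳ log₂ r ÷ʳ fromℕ r) →
  Eventually λ r →
    let open KSum k (reduction k A) r (p r) {{prime⇒nonZero (prime r)}} ((C + 16 * C′) * T r)
    in HaltsInTime × half d ℚ.≤ Pr experiment
reduction-solves {Δ} ordered {q} {u} {v} Δ<q q<1 u<v ρ≡ T (C′ , r₁ , linear) A (C , c , _ , solves) {d} 1/d≤c
  k 1≤k p prime k<p density =
  let r₂ , close  = subsetSumDensity (1ℚ ℚ.- q) (0<1-q q<1)
      r₃ , solved = solves p primePower subsetSumDensity
  -- Beyond `k` there are subsets of size `k`, and beyond `M ^ u` the gap holds; the other
  -- thresholds belong to the linear bound on `T`, the density and the given algorithm.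
  in (k ⊔ M ^ u) ⊔ ((r₁ ⊔ r₂) ⊔ r₃) , λ r large →
  let k⊔M≤r  = m⊔n≤o⇒m≤o (k ⊔ M ^ u) ((r₁ ⊔ r₂) ⊔ r₃) large
      rest≤r = m⊔n≤o⇒n≤o (k ⊔ M ^ u) ((r₁ ⊔ r₂) ⊔ r₃) large
      r₁₂≤r  = m⊔n≤o⇒m≤o (r₁ ⊔ r₂) r₃ rest≤r
      below , _ = close r (m⊔n≤o⇒n≤o r₁ r₂ r₁₂≤r)
  in reduction-correct A {k} {r} {p r} (prime⇒nonZero (prime r)) (prime r) 1≤k (k<p r)
       (m⊔n≤o⇒m≤o k (M ^ u) k⊔M≤r) (C * T r) ((C + 16 * C′) * T r) {c} {d}
       (time (T r) (linear r (m⊔n≤o⇒m≤o r₁ r₂ r₁₂≤r))) 1/d≤c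
       (power⇒gap M {u} {v} {r} {p r} u<v
         (density⇒power {Δ} {q} {1ℚ ℚ.- q} {u} {v} ordered Δ<q ρ≡ r (p r) below)
         (m⊔n≤o⇒n≤o k (M ^ u) k⊔M≤r))
       (solved r (m⊔n≤o⇒n≤o (r₁ ⊔ r₂) r₃ rest≤r))
  where
  -- The denominator of `half d`, so that a gap by the factor `M` means 2^r / p ≤ `half d`.
  M = suc (d + suc d)
  primePower : ∀ r → PrimePower (p r)
  primePower r = p r , 1 , prime r , ≤-refl , sym (^-identityʳ (p r))
  subsetSumDensity : (λ r → fromℕ r ÷ʳ log₂ (p r)) ∼ (λ _ → Δ)
  subsetSumDensity = kSumDensity⇒subsetSumDensity {Δ} {k} {p} density
  -- Here T(r) = Ω(r) absorbs the linear overhead of masking and unmasking.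
  time : ∀ {r} t → r ≤ C′ * t → C * t + 16 * r ≤ (C + 16 * C′) * t
  time {r} t r≤ = ≤-trans (+-monoʳ-≤ (C * t) (*-monoʳ-≤ 16 r≤)) (≤-reflexive (distribute C C′ t))
    where
    distribute : ∀ C C′ t → C * t + 16 * (C′ * t) ≡ (C + 16 * C′) * t
    distribute = solve-∀

theorem4p22 : (Δ : Cut) → IsReal Δ → fromℚ 0ℚ <ʳ Δ → Δ <ʳ fromℚ 1ℚ →
    (T : ℕ → ℕ) → AtLeastLinear T →
    (∃ λ (A : Program) → SolvesSubsetSum A Δ T) →
    (k : ℕ) → 1 ≤ k →
    ∃ λ (B : Program) →
    SolvesPlantedKSum k B (λ r → fromℕ k ·ʳ Δ ·ʳ log₂ r ÷ʳ fromℕ r) T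
theorem4p22 Δ real (a , 0<a , a<Δ) (q , Δ<q , q<1) T linear@(C′ , _) (A , solves@(C , c , 0<c , _)) k 1≤k =
  let ordered = IsReal⇒ordered {Δ} real
      d , 1/d≤c = reciprocal-≤ 0<c
      -- The rational `q` separating `Δ` from 1 also fixes the tolerance `1 - q` at which the
      -- density limit is used; it is positive because `0 < a < Δ < q`.
      u , v , u<v , ρ≡ = margin (ℚₚ.<-trans 0<a (ordered a<Δ Δ<q)) q<1
  in reduction k A , C + 16 * C′ , half d , frac-< {0} {0} {1} {d + suc d} (s≤s z≤n) ,
     reduction-solves {Δ} ordered {q} {u} {v} Δ<q q<1 u<v ρ≡ T linear A solves {d} 1/d≤c k 1≤k
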